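{- Let $n\ge1$. If $n$ is even, then the number of permutations $\pi\in\mathcal{S}_n$ for which $\mathrm{lbsum}(\pi)$ is even equals the number of permutations $\pi\in\mathcal{S}_n$ for which $\mathrm{lbsum}(\pi)$ is odd. If $n$ is odd, then these two numbers differ by the tangent number $T_n$.
   Context: $\mathcal{S}_n$ is the set of permutations $\pi=\pi_1\cdots\pi_n$ of $\{1,\ldots,n\}$. The left border number $a_i$ of $\pi$ is the largest position $m<i$ with $\pi_m>\pi_i$, or $0$ if no such position exists, and $\mathrm{lbsum}(\pi)=a_1+\cdots+a_n$. For odd $n$, the tangent number $T_n$ is defined by $\tan z=\sum_{n\text{ odd}}T_n\frac{z^n}{n!}$, so $T_1=1$, $T_3=2$, $T_5=16$, $T_7=272$. -}

module Defs where

open import Algebra.Bundles using (CommutativeRing)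
import Algebra.Properties.Semiring.Sum as SemiringSum
open import Data.Fin.Base using (Fin; toℕ) renaming (_<_ to _<ᶠ_)
open import Data.Fin.Properties using (_<?_; _≟_)
open import Data.Integer.Base as ℤ using (ℤ; +_; 0ℤ; 1ℤ)
open import Data.List.Base using (List; []; _∷_; allFin; cartesianProductWith; filter; length; map)
open import Data.List.Extrema.Nat using (max)
open import Data.Nat.Base using (ℕ; zero; suc; _∸_; _!; parity)
open import Data.Nat.Properties using (_!≢0)
open import Data.Nat.ListAction using (sum)
open import Data.Parity.Base using (Parity)
open import Data.Parity.Properties using () renaming (_≟_ to _≟ℙ_)
open import Data.Product.Base using (_×_)
open import Data.Rational.Base using (ℚ; _+_; _*_; _-_; -_; 0ℚ; 1ℚ; _/_)
open import Data.Rational.Properties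
  using (+-*-commutativeRing; +-identityʳ; +-comm; +-assoc; +-inverseˡ; *-identityʳ)
open import Data.Vec.Base using (Vec; []; _∷_; lookup)
open import Data.Vec.Relation.Unary.AllPairs using (allPairs?)
open import Data.Vec.Relation.Unary.Unique.Propositional using (Unique)
open import Relation.Binary.PropositionalEquality
  using (_≡_; _≗_; refl; cong; module ≡-Reasoning)
open import Relation.Nullary.Decidable using (¬?; _×-dec_)
open import Relation.Unary using (Decidable)

open SemiringSum (CommutativeRing.semiring +-*-commutativeRing)
  using () renaming (sum to ∑)

words : ∀ n k → List (Vec (Fin n) k)
words n zero    = [] ∷ []
words n (suc k) = cartesianProductWith _∷_ (allFin n) (words n k)

unique? : ∀ {n k} → Decidable (Unique {A = Fin n} {n = k})
unique? = allPairs? (λ x y → ¬? (x ≟ y))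

-- Each permutation in one-line notation, listed once: the words of length n
-- over n letters without repeated letter.  The element i of Fin n stands for
-- the letter (respectively the position) suc (toℕ i).
𝒮 : ∀ n → List (Vec (Fin n) n)
𝒮 n = filter unique? (words n n)

leftBorder : ∀ {n} → Vec (Fin n) n → Fin n → ℕ
leftBorder {n} π i = max 0 (map (λ m → suc (toℕ m)) (filter larger? (allFin n)))
  where
  larger? : Decidable (λ m → m <ᶠ i × lookup π i <ᶠ lookup π m)
  larger? m = (m <? i) ×-dec (lookup π i <? lookup π m)

lbsum : ∀ {n} → Vec (Fin n) n → ℕ
lbsum {n} π = sum (map (leftBorder π) (allFin n))

-- The number of π in 𝒮 n whose lbsum has parity p.
#lbsum : ℕ → Parity → ℕ
#lbsum n p = length (filter (λ π → parity (lbsum π) ≟ℙ p) (𝒮 n))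

-- Formal power series over ℚ, given by their ordinary coefficients [zⁿ].
Series : Set
Series = ℕ → ℚ

infixl 7 _⊛_ _⊘_

_⊛_ : Series → Series → Series
(f ⊛ g) n = ∑ {suc n} (λ k → f (toℕ k) * g (n ∸ toℕ k))

-- Long division, meaningful when g has constant term 1 (see ⊘-⊛):
-- f = f₀ g + z h with h the series in the recursive call, so
-- f / g = f₀ + z (h / g).
_⊘_ : Series → Series → Series
(f ⊘ g) zero    = f 0
(f ⊘ g) (suc n) = ((λ m → f (suc m) - f 0 * g (suc m)) ⊘ g) n

⊘-⊛ : ∀ f g → g 0 ≡ 1ℚ → (f ⊘ g) ⊛ g ≗ f
⊘-⊛ f g g₀≡1 zero = begin
  f 0 * g 0 + 0ℚ  ≡⟨ +-identityʳ _ ⟩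
  f 0 * g 0       ≡⟨ cong (f 0 *_) g₀≡1 ⟩
  f 0 * 1ℚ        ≡⟨ *-identityʳ (f 0) ⟩
  f 0             ∎
  where open ≡-Reasoning
⊘-⊛ f g g₀≡1 (suc n) = begin
  x + ((h ⊘ g) ⊛ g) n    ≡⟨ cong (_+_ x) (⊘-⊛ h g g₀≡1 n) ⟩
  x + (f (suc n) - x)    ≡⟨ +-comm x _ ⟩
  (f (suc n) - x) + x    ≡⟨ +-assoc (f (suc n)) (- x) x ⟩
  f (suc n) + (- x + x)  ≡⟨ cong (_+_ (f (suc n))) (+-inverseˡ x) ⟩
  f (suc n) + 0ℚ         ≡⟨ +-identityʳ _ ⟩
  f (suc n)              ∎
  where
  open ≡-Reasoning
  x : ℚ
  x = f 0 * g (suc n)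
  h : Series
  h m = f (suc m) - f 0 * g (suc m)

-- n! [zⁿ] of sin and cos: the n-th derivatives at 0.
sin⁽_⁾ : ℕ → ℤ
sin⁽ 0 ⁾           = 0ℤ
sin⁽ 1 ⁾           = 1ℤ
sin⁽ suc (suc n) ⁾ = ℤ.- sin⁽ n ⁾

cos⁽_⁾ : ℕ → ℤ
cos⁽ 0 ⁾           = 1ℤ
cos⁽ 1 ⁾           = 0ℤ
cos⁽ suc (suc n) ⁾ = ℤ.- cos⁽ n ⁾

sin cos tan : Series
sin n = (sin⁽ n ⁾ / (n !)) {{n !≢0}}
cos n = (cos⁽ n ⁾ / (n !)) {{n !≢0}}
tan = sin ⊘ cos

tan-cos : tan ⊛ cos ≗ sin
tan-cos = ⊘-⊛ sin cos refl

-- The coefficient of zⁿ/n! in tan z.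
T : ℕ → ℚ
T n = (+ (n !) / 1) * tan n

{-# OPTIONS --safe #-}
module Submission where

-- Let D n be the sum of (−1)^lbsum(π) over all π in 𝒮 n.  If the largest letter
-- x of π = σ x τ stands at position |σ| + 1, then every border number of a letter
-- of τ exceeds the one computed inside τ by |σ| + 1, whence
--   lbsum(σ x τ) = lbsum(σ) + |τ| (|σ| + 1) + lbsum(τ).
-- Summing over all π gives D (m + 1) = Σ (−1)^(j (i + 1)) C(m, i) D i D j over
-- i + j = m.  For odd m the terms (i, j) and (j, i) cancel, so D vanishes at
-- positive even arguments; for even m all signs are +.  Hence the exponential
-- generating function y of the odd part of D satisfies y′ = 1 + y², y(0) = 0,
-- so that y = tan z.

open import Defs
open import Data.Bool.Base using (Bool; true; false; _∧_)
open import Data.Fin.Base using (Fin; toℕ) renaming (zero to fzero; suc to fsuc)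
import Data.Fin.Properties as Fin
open import Data.Integer.Base as ℤ using (ℤ; +_; -[1+_]; 0ℤ; 1ℤ; _+_; _*_; -_; _-_)
import Data.Integer.Properties as ℤ
open import Data.Integer.Tactic.RingSolver using (solve-∀)
open import Data.List.Base as List
  using ( List; []; _∷_; _++_; length; map; filter; zipWith; allFin; tabulate; applyUpTo
        ; upTo; downFrom; reverse; cartesianProductWith)
open import Data.List.Extrema.Nat using (max; max≤v⁺; xs≤max)
import Data.List.Membership.DecPropositional as DecMembership
open import Data.List.Membership.Propositional using (_∈_; _∉_)
open import Data.List.Membership.Propositional.Properties
  using (∈-filter⁺; ∈-filter⁻; ∈-allFin)
open import Data.List.Membership.Propositional.Properties.WithK using (unique∧set⇒bag)
import Data.List.Properties as List
open import Data.List.Relation.Binary.BagAndSetEquality using (∼bag⇒↭)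
open import Data.List.Relation.Binary.Permutation.Propositional as Perm
  using (_↭_; ↭-refl; ↭-sym; ↭-prep; ↭-trans; ↭-swap; ↭⇒↭ₛ)
open import Data.List.Relation.Binary.Permutation.Propositional.Properties
  using (shift; ↭-length; ↭-reverse; ∈-resp-↭; All-resp-↭)
import Data.List.Relation.Binary.Permutation.Setoid.Properties as SetoidPerm
open import Data.List.Relation.Binary.Sublist.Propositional
  using (_⊆_; ⊆-refl; []; _∷ʳ_; _∷_)
open import Data.List.Relation.Binary.Sublist.Propositional.Properties
  using (All-resp-⊆; length-mono-≤)
open import Data.List.Relation.Unary.All as All using (All; []; _∷_)
import Data.List.Relation.Unary.All.Properties as All
open import Data.List.Relation.Unary.AllPairs using (AllPairs; []; _∷_)
open import Data.List.Relation.Unary.AllPairs.Properties using (applyDownFrom⁺₁)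
open import Data.List.Relation.Unary.Any using (here; there)
open import Data.List.Relation.Unary.Unique.Propositional using ()
  renaming (Unique to Distinct)
import Data.List.Relation.Unary.Unique.Propositional.Properties as Distinct
open import Data.Nat.Base as ℕ
  using ( ℕ; zero; suc; _≤_; _<_; _>_; z≤n; s≤s; _<ᵇ_; _⊔_; ∣_-_∣; _!; NonZero; parity)
open import Data.Nat.ListAction using (sum)
open import Data.Nat.ListAction.Properties using (sum-++)
import Data.Nat.Properties as ℕ
open import Data.Nat.Properties using (_!≢0)
import Data.Nat.Tactic.RingSolver as ℕSolver
open import Data.Parity.Base as ℙ using (Parity; 0ℙ; 1ℙ)
import Data.Parity.Properties as ℙ
open import Data.Product.Base using (_×_; _,_; proj₁; proj₂)
open import Data.Rational.Base as ℚ using (ℚ; 0ℚ; 1ℚ; _/_)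
import Data.Rational.Properties as ℚ
open import Data.Rational.Solver using (module +-*-Solver)
open import Data.Rational.Unnormalised.Base as ℚᵘ using (mkℚᵘ; *≡*)
import Data.Rational.Unnormalised.Properties as ℚᵘ
open import Data.Vec.Base using (Vec; []; _∷_; toList; lookup)
import Data.Vec.Relation.Unary.All as VecAll
import Data.Vec.Relation.Unary.AllPairs as VecAllPairs
open import Data.Vec.Relation.Unary.Unique.Propositional using (Unique)
open import Function.Base using (_∘_; const; id)
open import Function.Bundles using (mk⇔)
open import Level using (0ℓ)
open import Relation.Binary.PropositionalEquality
open import Relation.Nullary.Decidable using (does; yes; no; _×-dec_; dec-true; dec-false)
open import Relation.Nullary.Negation using (¬_; contradiction)
open import Relation.Unary using (Pred; Decidable; _≐_)

open +-*-Solver using (solve; _:=_; _:+_; _:*_; _:-_; con)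

-- The letters of σ and τ form arbitrary complementary sets, so cutting at the largest letter would
-- ordinarily call for standardising both factors and for counting subsets. Both are avoided by
-- summing over the permutations of an arbitrary list: for a decreasing list the signed sum depends
-- on the length alone, because all decreasing lists obey one recurrence. Binomial coefficients stay
-- implicit as well: deciding for each letter in turn whether it joins σ or τ is the Leibniz rule
-- that defines `_⊙_`. Hence the series are integer sequences almost throughout, and fractions enter
-- only in the comparison with `tan`, a quotient of rational series. The theorem compares the two
-- counts only up to sign; this costs one further observation, that D is never negative.

private variable
  A B C : Set

-- Exponential generating functions

sgn : Parity → ℤ
sgn 0ℙ = 1ℤ
sgn 1ℙ = - 1ℤ

sgn-homo : ∀ p q → sgn (p ℙ.+ q) ≡ sgn p * sgn q
sgn-homo 0ℙ 0ℙ = refl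
sgn-homo 0ℙ 1ℙ = refl
sgn-homo 1ℙ 0ℙ = refl
sgn-homo 1ℙ 1ℙ = refl

sgn-⁻¹ : ∀ p → sgn (p ℙ.⁻¹) ≡ - sgn p
sgn-⁻¹ 0ℙ = refl
sgn-⁻¹ 1ℙ = refl

parity-suc : ∀ n → parity (suc n) ≡ parity n ℙ.⁻¹
parity-suc n = sym (ℙ.⁻¹-selfInverse (ℙ.suc-homo-⁻¹ n))

infixl 7 _⊙_

-- Exponential generating functions as the sequences of their derivatives at 0:
-- differentiation is _∘ suc, and the second clause is the Leibniz rule.
_⊙_ : (ℕ → ℤ) → (ℕ → ℤ) → ℕ → ℤ
(a ⊙ b) zero    = a 0 * b 0
(a ⊙ b) (suc n) = (a ∘ suc ⊙ b) n + (a ⊙ b ∘ suc) n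

-- The hypotheses are bounded by `n` so that strong induction on the index can supply them, as in
-- `u≡0`.
⊙-cong : ∀ {a a′ b b′} n → (∀ k → k ≤ n → a k ≡ a′ k) → (∀ k → k ≤ n → b k ≡ b′ k) →
         (a ⊙ b) n ≡ (a′ ⊙ b′) n
⊙-cong zero    p q = cong₂ _*_ (p 0 z≤n) (q 0 z≤n)
⊙-cong (suc n) p q = cong₂ _+_
  (⊙-cong n (λ k → p (suc k) ∘ s≤s) (λ k → q k ∘ ℕ.m≤n⇒m≤1+n))
  (⊙-cong n (λ k → p k ∘ ℕ.m≤n⇒m≤1+n) (λ k → q (suc k) ∘ s≤s))

⊙-congˡ : ∀ {a b b′} n → b ≗ b′ → (a ⊙ b) n ≡ (a ⊙ b′) n
⊙-congˡ n q = ⊙-cong n (λ _ _ → refl) (λ k _ → q k)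

⊙-congʳ : ∀ {a a′ b} n → a ≗ a′ → (a ⊙ b) n ≡ (a′ ⊙ b) n
⊙-congʳ n p = ⊙-cong n (λ k _ → p k) (λ _ _ → refl)

⊙-comm : ∀ a b n → (a ⊙ b) n ≡ (b ⊙ a) n
⊙-comm a b zero    = ℤ.*-comm (a 0) (b 0)
⊙-comm a b (suc n) = trans (ℤ.+-comm ((a ∘ suc ⊙ b) n) ((a ⊙ b ∘ suc) n))
  (cong₂ _+_ (⊙-comm a (b ∘ suc) n) (⊙-comm (a ∘ suc) b n))

⊙-distribˡ-+ : ∀ a b c n → (a ⊙ (λ k → b k + c k)) n ≡ (a ⊙ b) n + (a ⊙ c) n
⊙-distribˡ-+ a b c zero    = ℤ.*-distribˡ-+ (a 0) (b 0) (c 0)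
⊙-distribˡ-+ a b c (suc n) = trans
  (cong₂ _+_ (⊙-distribˡ-+ (a ∘ suc) b c n) (⊙-distribˡ-+ a (b ∘ suc) (c ∘ suc) n))
  (interchange ((a ∘ suc ⊙ b) n) ((a ∘ suc ⊙ c) n) ((a ⊙ b ∘ suc) n) ((a ⊙ c ∘ suc) n))
  where
  interchange : ∀ x y z t → (x + y) + (z + t) ≡ (x + z) + (y + t)
  interchange = solve-∀

⊙-distribʳ-+ : ∀ a b c n → ((λ k → b k + c k) ⊙ a) n ≡ (b ⊙ a) n + (c ⊙ a) n
⊙-distribʳ-+ a b c n = begin
  ((λ k → b k + c k) ⊙ a) n    ≡⟨ ⊙-comm (λ k → b k + c k) a n ⟩
  (a ⊙ (λ k → b k + c k)) n    ≡⟨ ⊙-distribˡ-+ a b c n ⟩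
  (a ⊙ b) n + (a ⊙ c) n        ≡⟨ cong₂ _+_ (⊙-comm a b n) (⊙-comm a c n) ⟩
  (b ⊙ a) n + (c ⊙ a) n        ∎
  where open ≡-Reasoning

⊙-assoc : ∀ a b c n → ((a ⊙ b) ⊙ c) n ≡ (a ⊙ (b ⊙ c)) n
⊙-assoc a b c zero    = ℤ.*-assoc (a 0) (b 0) (c 0)
⊙-assoc a b c (suc n) = begin
  ((λ k → (a ∘ suc ⊙ b) k + (a ⊙ b ∘ suc) k) ⊙ c) n + ((a ⊙ b) ⊙ c ∘ suc) n
    ≡⟨ cong (_+ ((a ⊙ b) ⊙ c ∘ suc) n) (⊙-distribʳ-+ c (a ∘ suc ⊙ b) (a ⊙ b ∘ suc) n) ⟩
  ((a ∘ suc ⊙ b) ⊙ c) n + ((a ⊙ b ∘ suc) ⊙ c) n + ((a ⊙ b) ⊙ c ∘ suc) n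
    ≡⟨ cong₂ _+_ (cong₂ _+_ (⊙-assoc (a ∘ suc) b c n) (⊙-assoc a (b ∘ suc) c n))
                 (⊙-assoc a b (c ∘ suc) n) ⟩
  (a ∘ suc ⊙ (b ⊙ c)) n + (a ⊙ (b ∘ suc ⊙ c)) n + (a ⊙ (b ⊙ c ∘ suc)) n
    ≡⟨ ℤ.+-assoc ((a ∘ suc ⊙ (b ⊙ c)) n) _ _ ⟩
  (a ∘ suc ⊙ (b ⊙ c)) n + ((a ⊙ (b ∘ suc ⊙ c)) n + (a ⊙ (b ⊙ c ∘ suc)) n)
    ≡⟨ cong (_+_ ((a ∘ suc ⊙ (b ⊙ c)) n)) (⊙-distribˡ-+ a (b ∘ suc ⊙ c) (b ⊙ c ∘ suc) n) ⟨
  (a ∘ suc ⊙ (b ⊙ c)) n + (a ⊙ (λ k → (b ∘ suc ⊙ c) k + (b ⊙ c ∘ suc) k)) n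
    ∎
  where open ≡-Reasoning

⊙-zeroʳ : ∀ a n → (a ⊙ const 0ℤ) n ≡ 0ℤ
⊙-zeroʳ a zero    = ℤ.*-zeroʳ (a 0)
⊙-zeroʳ a (suc n) = cong₂ _+_ (⊙-zeroʳ (a ∘ suc) n) (⊙-zeroʳ a n)

⊙-negʳ : ∀ a b n → (a ⊙ (-_ ∘ b)) n ≡ - (a ⊙ b) n
⊙-negʳ a b zero    = sym (ℤ.neg-distribʳ-* (a 0) (b 0))
⊙-negʳ a b (suc n) = trans (cong₂ _+_ (⊙-negʳ (a ∘ suc) b n) (⊙-negʳ a (b ∘ suc) n))
                           (sym (ℤ.neg-distrib-+ ((a ∘ suc ⊙ b) n) _))

⊙-negˡ : ∀ a b n → ((-_ ∘ a) ⊙ b) n ≡ - (a ⊙ b) n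
⊙-negˡ a b n = trans (⊙-comm (-_ ∘ a) b n) (trans (⊙-negʳ b a n) (cong -_ (⊙-comm b a n)))

one : ℕ → ℤ
one zero    = 1ℤ
one (suc _) = 0ℤ

⊙-identityˡ : ∀ a n → (one ⊙ a) n ≡ a n
⊙-identityˡ a zero    = ℤ.*-identityˡ (a 0)
⊙-identityˡ a (suc n) = trans
  (cong₂ _+_ (trans (⊙-comm (const 0ℤ) a n) (⊙-zeroʳ a n)) (⊙-identityˡ (a ∘ suc) n))
  (ℤ.+-identityˡ (a (suc n)))

⊙-nonNeg : ∀ {a b} n → (∀ k → k ≤ n → 0ℤ ℤ.≤ a k) → (∀ k → k ≤ n → 0ℤ ℤ.≤ b k) →
           0ℤ ℤ.≤ (a ⊙ b) n
⊙-nonNeg {a} {b} zero p q = subst (ℤ._≤ a 0 * b 0) (ℤ.*-zeroʳ (a 0))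
  (ℤ.*-monoˡ-≤-nonNeg (a 0) {{ℤ.nonNegative (p 0 z≤n)}} (q 0 z≤n))
⊙-nonNeg (suc n) p q = ℤ.+-mono-≤
  (⊙-nonNeg n (λ k → p (suc k) ∘ s≤s) (λ k → q k ∘ ℕ.m≤n⇒m≤1+n))
  (⊙-nonNeg n (λ k → p k ∘ ℕ.m≤n⇒m≤1+n) (λ k → q (suc k) ∘ s≤s))

-- The exponential generating function a(−z).
alternate : (ℕ → ℤ) → ℕ → ℤ
alternate a n = sgn (parity n) * a n

alternate-suc : ∀ a n → alternate a (suc n) ≡ - alternate (a ∘ suc) n
alternate-suc a n = begin
  sgn (parity (suc n)) * a (suc n)   ≡⟨ cong (λ p → sgn p * a (suc n)) (parity-suc n) ⟩
  sgn (parity n ℙ.⁻¹) * a (suc n)    ≡⟨ cong (_* a (suc n)) (sgn-⁻¹ (parity n)) ⟩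
  - sgn (parity n) * a (suc n)       ≡⟨ ℤ.neg-distribˡ-* (sgn (parity n)) (a (suc n)) ⟨
  - (sgn (parity n) * a (suc n))     ∎
  where open ≡-Reasoning

-- Substituting -z for z respects products: each differentiation contributes one sign, whichever
-- factor it hits.
alternate-⊙ : ∀ a b n → (alternate a ⊙ alternate b) n ≡ alternate (a ⊙ b) n
alternate-⊙ a b zero = trans
  (cong₂ _*_ (ℤ.*-identityˡ (a 0)) (ℤ.*-identityˡ (b 0)))
  (sym (ℤ.*-identityˡ (a 0 * b 0)))
alternate-⊙ a b (suc n) = begin
  (alternate a ∘ suc ⊙ alternate b) n + (alternate a ⊙ alternate b ∘ suc) n
    ≡⟨ cong₂ _+_ (⊙-congʳ n (alternate-suc a)) (⊙-congˡ n (alternate-suc b)) ⟩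
  ((-_ ∘ alternate (a ∘ suc)) ⊙ alternate b) n + (alternate a ⊙ (-_ ∘ alternate (b ∘ suc))) n
    ≡⟨ cong₂ _+_ (⊙-negˡ (alternate (a ∘ suc)) (alternate b) n)
                 (⊙-negʳ (alternate a) (alternate (b ∘ suc)) n) ⟩
  - (alternate (a ∘ suc) ⊙ alternate b) n + - (alternate a ⊙ alternate (b ∘ suc)) n
    ≡⟨ cong₂ (λ x y → - x + - y) (alternate-⊙ (a ∘ suc) b n) (alternate-⊙ a (b ∘ suc) n) ⟩
  - alternate (a ∘ suc ⊙ b) n + - alternate (a ⊙ b ∘ suc) n
    ≡⟨ collect (sgn (parity n)) ((a ∘ suc ⊙ b) n) ((a ⊙ b ∘ suc) n) ⟩
  - (sgn (parity n) * (a ⊙ b) (suc n))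
    ≡⟨ alternate-suc (a ⊙ b) n ⟨
  alternate (a ⊙ b) (suc n) ∎
  where
  open ≡-Reasoning
  collect : ∀ s x y → - (s * x) + - (s * y) ≡ - (s * (x + y))
  collect = solve-∀

-- Sums over permutations

insertSum : A → (List A → ℤ) → List A → ℤ
insertSum x f []      = f (x ∷ [])
insertSum x f (y ∷ π) = f (x ∷ y ∷ π) + insertSum x (f ∘ (y ∷_)) π

-- Permutations are generated by insertion, so that insertSum x is a derivation
-- for the product ⋆ below, and permSum turns ⋆ into ⊙.
permSum : (List A → ℤ) → List A → ℤ
permSum f []      = f []
permSum f (x ∷ L) = permSum (insertSum x f) L

infixl 7 _⋆_

-- The sum of f σ * g τ over all factorisations of a word as σ ++ τ.
_⋆_ : (List A → ℤ) → (List A → ℤ) → List A → ℤ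
(f ⋆ g) []      = f [] * g []
(f ⋆ g) (y ∷ π) = f [] * g (y ∷ π) + (f ∘ (y ∷_) ⋆ g) π

insertSum-cong : ∀ {x : A} {f g} π → (∀ σ τ → σ ++ τ ≡ π → f (σ ++ x ∷ τ) ≡ g (σ ++ x ∷ τ)) →
                 insertSum x f π ≡ insertSum x g π
insertSum-cong []      f≡g = f≡g [] [] refl
insertSum-cong (y ∷ π) f≡g = cong₂ _+_ (f≡g [] (y ∷ π) refl)
  (insertSum-cong π (λ σ τ → f≡g (y ∷ σ) τ ∘ cong (y ∷_)))

insertSum-+ : ∀ (x : A) f g π →
              insertSum x (λ ρ → f ρ + g ρ) π ≡ insertSum x f π + insertSum x g π
insertSum-+ x f g []      = refl
insertSum-+ x f g (y ∷ π) = trans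
  (cong (_+_ (f (x ∷ y ∷ π) + g (x ∷ y ∷ π))) (insertSum-+ x (f ∘ (y ∷_)) (g ∘ (y ∷_)) π))
  (interchange (f (x ∷ y ∷ π)) (g (x ∷ y ∷ π)) (insertSum x (f ∘ (y ∷_)) π)
               (insertSum x (g ∘ (y ∷_)) π))
  where
  interchange : ∀ a b c d → (a + b) + (c + d) ≡ (a + c) + (b + d)
  interchange = solve-∀

insertSum-*ˡ : ∀ (x : A) c f π → insertSum x (λ ρ → c * f ρ) π ≡ c * insertSum x f π
insertSum-*ˡ x c f []      = refl
insertSum-*ˡ x c f (y ∷ π) = trans
  (cong (_+_ (c * f (x ∷ y ∷ π))) (insertSum-*ˡ x c (f ∘ (y ∷_)) π))
  (sym (ℤ.*-distribˡ-+ c (f (x ∷ y ∷ π)) (insertSum x (f ∘ (y ∷_)) π)))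

insertSum-map : ∀ (h : A → B) x f π → insertSum x (f ∘ map h) π ≡ insertSum (h x) f (map h π)
insertSum-map h x f []      = refl
insertSum-map h x f (y ∷ π) =
  cong (_+_ (f (h x ∷ h y ∷ map h π))) (insertSum-map h x (f ∘ (h y ∷_)) π)

⋆-distribʳ-+ : ∀ (f g k : List A → ℤ) π →
               ((λ ρ → f ρ + g ρ) ⋆ k) π ≡ (f ⋆ k) π + (g ⋆ k) π
⋆-distribʳ-+ f g k []      = ℤ.*-distribʳ-+ (k []) (f []) (g [])
⋆-distribʳ-+ f g k (y ∷ π) = trans
  (cong (_+_ ((f [] + g []) * k (y ∷ π))) (⋆-distribʳ-+ (f ∘ (y ∷_)) (g ∘ (y ∷_)) k π))
  (interchange (f []) (g []) (k (y ∷ π)) ((f ∘ (y ∷_) ⋆ k) π) ((g ∘ (y ∷_) ⋆ k) π))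
  where
  interchange : ∀ a b c d e → (a + b) * c + (d + e) ≡ (a * c + d) + (b * c + e)
  interchange = solve-∀

-- A cut of a word containing `x` leaves `x` on exactly one side. An insertion exactly between σ and
-- τ admits both cuts, before and after `x`, one for each summand.
insertSum-⋆ : ∀ (x : A) f g π →
              insertSum x (f ⋆ g) π ≡ (insertSum x f ⋆ g) π + (f ⋆ insertSum x g) π
insertSum-⋆ x f g []      = ℤ.+-comm (f [] * g (x ∷ [])) (f (x ∷ []) * g [])
insertSum-⋆ x f g (y ∷ π) = begin
  f [] * gxy + (f (x ∷ []) * gy + fxy) + insertSum x (λ ρ → f [] * g (y ∷ ρ) + (f′ ⋆ g) ρ) π
    ≡⟨ cong (_+_ (f [] * gxy + (f (x ∷ []) * gy + fxy)))
         (insertSum-+ x (λ ρ → f [] * g (y ∷ ρ)) (f′ ⋆ g) π) ⟩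
  f [] * gxy + (f (x ∷ []) * gy + fxy)
    + (insertSum x (λ ρ → f [] * g (y ∷ ρ)) π + insertSum x (f′ ⋆ g) π)
    ≡⟨ cong (_+_ (f [] * gxy + (f (x ∷ []) * gy + fxy)))
         (cong₂ _+_ (insertSum-*ˡ x (f []) (g ∘ (y ∷_)) π) (insertSum-⋆ x f′ g π)) ⟩
  f [] * gxy + (f (x ∷ []) * gy + fxy)
    + (f [] * gy′ + ((insertSum x f′ ⋆ g) π + (f′ ⋆ insertSum x g) π))
    ≡⟨ rearrange (f []) gxy (f (x ∷ []) * gy) fxy gy′ ((insertSum x f′ ⋆ g) π)
         ((f′ ⋆ insertSum x g) π) ⟩
  f (x ∷ []) * gy + (fxy + (insertSum x f′ ⋆ g) π)
    + (f [] * (gxy + gy′) + (f′ ⋆ insertSum x g) π)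
    ≡⟨ cong (λ t → f (x ∷ []) * gy + t + (f [] * (gxy + gy′) + (f′ ⋆ insertSum x g) π))
         (⋆-distribʳ-+ (f ∘ (x ∷_) ∘ (y ∷_)) (insertSum x f′) g π) ⟨
  (insertSum x f ⋆ g) (y ∷ π) + (f ⋆ insertSum x g) (y ∷ π) ∎
  where
  open ≡-Reasoning
  f′ = f ∘ (y ∷_)
  gxy = g (x ∷ y ∷ π)
  gy  = g (y ∷ π)
  gy′ = insertSum x (g ∘ (y ∷_)) π
  fxy = (f ∘ (x ∷_) ∘ (y ∷_) ⋆ g) π
  rearrange : ∀ f₀ gxy fgy fxy gy′ p q →
    f₀ * gxy + (fgy + fxy) + (f₀ * gy′ + (p + q)) ≡ fgy + (fxy + p) + (f₀ * (gxy + gy′) + q)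
  rearrange = solve-∀

-- A place of insertion is a cut of `π`. The equation `σ ++ τ ≡ π` lets the caller use what is known
-- about `π` when splitting `f`.
insertSum-factor : ∀ {x : A} {f g h} π →
                   (∀ σ τ → σ ++ τ ≡ π → f (σ ++ x ∷ τ) ≡ g σ * h τ) →
                   insertSum x f π ≡ (g ⋆ h) π
insertSum-factor []      split = split [] [] refl
insertSum-factor (y ∷ π) split = cong₂ _+_ (split [] (y ∷ π) refl)
  (insertSum-factor π (λ σ τ → split (y ∷ σ) τ ∘ cong (y ∷_)))

-- The restriction to `π ↭ L` is what makes the length of `L` and bounds on its letters available
-- under the sum.
permSum-cong : ∀ {f g} (L : List A) → (∀ π → π ↭ L → f π ≡ g π) → permSum f L ≡ permSum g L
permSum-cong []      f≡g = f≡g [] ↭-refl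
permSum-cong (x ∷ L) f≡g = permSum-cong L λ π π↭L → insertSum-cong π λ σ τ σ++τ≡π →
  f≡g (σ ++ x ∷ τ) (↭-trans (shift x σ τ) (↭-prep x (subst (_↭ L) (sym σ++τ≡π) π↭L)))

permSum-+ : ∀ f g (L : List A) → permSum (λ π → f π + g π) L ≡ permSum f L + permSum g L
permSum-+ f g []      = refl
permSum-+ f g (x ∷ L) = trans (permSum-cong L λ π _ → insertSum-+ x f g π)
                              (permSum-+ (insertSum x f) (insertSum x g) L)

permSum-*ˡ : ∀ c f (L : List A) → permSum (λ π → c * f π) L ≡ c * permSum f L
permSum-*ˡ c f []      = refl
permSum-*ˡ c f (x ∷ L) = trans (permSum-cong L λ π _ → insertSum-*ˡ x c f π)
                               (permSum-*ˡ c (insertSum x f) L)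

permSum-map : ∀ (h : A → B) f L → permSum (f ∘ map h) L ≡ permSum f (map h L)
permSum-map h f []      = refl
permSum-map h f (x ∷ L) = trans (permSum-cong L λ π _ → insertSum-map h x f π)
                                (permSum-map h (insertSum (h x) f) L)

-- Each letter of `L` goes to the left or to the right factor, so the factors are permutations of
-- complementary sublists; hence hypotheses about all `M ⊆ L`. A letter given to the left factor
-- turns `f` into `insertSum x f` and `a` into `a ∘ suc`.
permSum-⋆ : ∀ (L : List A) {f g a b} →
            (∀ {M} → M ⊆ L → permSum f M ≡ a (length M)) →
            (∀ {M} → M ⊆ L → permSum g M ≡ b (length M)) →
            permSum (f ⋆ g) L ≡ (a ⊙ b) (length L)
permSum-⋆ []      p q = cong₂ _*_ (p ⊆-refl) (q ⊆-refl)
permSum-⋆ (x ∷ L) {f} {g} p q = trans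
  (permSum-cong L λ π _ → insertSum-⋆ x f g π)
  (trans (permSum-+ (insertSum x f ⋆ g) (f ⋆ insertSum x g) L) (cong₂ _+_
    (permSum-⋆ L (p ∘ (refl ∷_)) (q ∘ (x ∷ʳ_)))
    (permSum-⋆ L (p ∘ (x ∷ʳ_)) (q ∘ (refl ∷_)))))

-- The sum of h y R over all ways of extracting an entry y from a list, leaving R.
selectSum : (A → List A → ℤ) → List A → ℤ
selectSum h []      = 0ℤ
selectSum h (x ∷ L) = h x L + selectSum (λ y R → h y (x ∷ R)) L

insertLater : A → (List A → ℤ) → List A → ℤ
insertLater x f []      = 0ℤ
insertLater x f (y ∷ π) = insertSum x (f ∘ (y ∷_)) π

insertSum-split : ∀ (x : A) f π → insertSum x f π ≡ f (x ∷ π) + insertLater x f π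
insertSum-split x f []      = sym (ℤ.+-identityʳ (f (x ∷ [])))
insertSum-split x f (y ∷ π) = refl

-- The bridge between insertion, which drives `permSum`, and the choice of a first letter, which
-- drives `words`: the head of the list either comes first or is inserted behind another first
-- letter. The hypothesis concerns the empty list, where the left side is `f []` and the right side
-- is 0.
permSum-first : ∀ f (L : List A) → (length L ≡ 0 → f [] ≡ 0ℤ) →
                permSum f L ≡ selectSum (λ y → permSum (f ∘ (y ∷_))) L
permSum-first f []      f[]≡0 = f[]≡0 refl
permSum-first f (x ∷ L) _ = begin
  permSum (insertSum x f) L
    ≡⟨ permSum-cong L (λ π _ → insertSum-split x f π) ⟩
  permSum (λ π → f (x ∷ π) + insertLater x f π) L
    ≡⟨ permSum-+ (f ∘ (x ∷_)) (insertLater x f) L ⟩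
  permSum (f ∘ (x ∷_)) L + permSum (insertLater x f) L
    ≡⟨ cong (_+_ (permSum (f ∘ (x ∷_)) L)) (permSum-first (insertLater x f) L (λ _ → refl)) ⟩
  selectSum (λ y → permSum (f ∘ (y ∷_))) (x ∷ L) ∎
  where open ≡-Reasoning

-- Sums over the duplicate-free words listed in `𝒮`

sumOver : (A → ℤ) → List A → ℤ
sumOver f []       = 0ℤ
sumOver f (x ∷ xs) = f x + sumOver f xs

sumOver-cong : ∀ {f g : A → ℤ} xs → f ≗ g → sumOver f xs ≡ sumOver g xs
sumOver-cong []       f≗g = refl
sumOver-cong (x ∷ xs) f≗g = cong₂ _+_ (f≗g x) (sumOver-cong xs f≗g)

sumOver-++ : ∀ (f : A → ℤ) xs ys → sumOver f (xs ++ ys) ≡ sumOver f xs + sumOver f ys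
sumOver-++ f []       ys = sym (ℤ.+-identityˡ _)
sumOver-++ f (x ∷ xs) ys = trans (cong (_+_ (f x)) (sumOver-++ f xs ys))
                                   (sym (ℤ.+-assoc (f x) (sumOver f xs) (sumOver f ys)))

sumOver-↭ : ∀ (f : A → ℤ) {xs ys} → xs ↭ ys → sumOver f xs ≡ sumOver f ys
sumOver-↭ f Perm.refl         = refl
sumOver-↭ f (Perm.prep x p)   = cong (_+_ (f x)) (sumOver-↭ f p)
sumOver-↭ f (Perm.swap {xs} {ys} x y p) = begin
  f x + (f y + sumOver f xs)  ≡⟨ ℤ.+-assoc (f x) (f y) _ ⟨
  f x + f y + sumOver f xs    ≡⟨ cong₂ _+_ (ℤ.+-comm (f x) (f y)) (sumOver-↭ f p) ⟩
  f y + f x + sumOver f ys    ≡⟨ ℤ.+-assoc (f y) (f x) _ ⟩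
  f y + (f x + sumOver f ys)  ∎
  where open ≡-Reasoning
sumOver-↭ f (Perm.trans p q)  = trans (sumOver-↭ f p) (sumOver-↭ f q)

sumOver-filter-map : ∀ {P : Pred B 0ℓ} (P? : Decidable P) (f : B → ℤ) (g : A → B) xs →
  sumOver f (filter P? (map g xs)) ≡ sumOver (f ∘ g) (filter (P? ∘ g) xs)
sumOver-filter-map P? f g []       = refl
sumOver-filter-map P? f g (x ∷ xs) with does (P? (g x))
... | true  = cong (_+_ (f (g x))) (sumOver-filter-map P? f g xs)
... | false = sumOver-filter-map P? f g xs

sumOver-filter-product : ∀ {P : Pred C 0ℓ} (P? : Decidable P) (f : C → ℤ)
  (g : A → B → C) xs ys →
  sumOver f (filter P? (cartesianProductWith g xs ys)) ≡
  sumOver (λ x → sumOver (f ∘ g x) (filter (P? ∘ g x) ys)) xs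
sumOver-filter-product P? f g []       ys = refl
sumOver-filter-product P? f g (x ∷ xs) ys = begin
  sumOver f (filter P? (map (g x) ys ++ cartesianProductWith g xs ys))
    ≡⟨ cong (sumOver f) (List.filter-++ P? (map (g x) ys) _) ⟩
  sumOver f (filter P? (map (g x) ys) ++ filter P? (cartesianProductWith g xs ys))
    ≡⟨ sumOver-++ f (filter P? (map (g x) ys)) _ ⟩
  sumOver f (filter P? (map (g x) ys)) + sumOver f (filter P? (cartesianProductWith g xs ys))
    ≡⟨ cong₂ _+_ (sumOver-filter-map P? f (g x) ys) (sumOver-filter-product P? f g xs ys) ⟩
  _ ∎
  where open ≡-Reasoning

sumOver-filter : ∀ {P : Pred A 0ℓ} (P? : Decidable P) {f : A → ℤ} xs →
                 (∀ x → ¬ P x → f x ≡ 0ℤ) → sumOver f (filter P? xs) ≡ sumOver f xs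
sumOver-filter P? []       z = refl
sumOver-filter P? {f} (x ∷ xs) z with P? x
... | yes _  = cong (_+_ (f x)) (sumOver-filter P? xs z)
... | no ¬Px = trans (sumOver-filter P? xs z)
  (trans (sym (ℤ.+-identityˡ _)) (cong (_+ sumOver f xs) (sym (z x ¬Px))))

selectSum-sumOver : ∀ (L : List A) {h h′} → (∀ {y R} → y ∷ R ↭ L → h y R ≡ h′ y) →
                    selectSum h L ≡ sumOver h′ L
selectSum-sumOver []      h≡h′ = refl
selectSum-sumOver (x ∷ L) h≡h′ = cong₂ _+_ (h≡h′ ↭-refl)
  (selectSum-sumOver L λ {y} y∷R↭L → h≡h′ (↭-trans (↭-swap y x ↭-refl) (↭-prep x y∷R↭L)))

module _ {n : ℕ} where
  open DecMembership (Fin._≟_ {n}) using (_∈?_)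

  -- Makes induction on the word length possible: once the first letter is removed, the rest is
  -- still a word over `Fin n`, but with its letters in a shorter list.
  Arrangement : List (Fin n) → ∀ {k} → Vec (Fin n) k → Set
  Arrangement L w = Unique w × VecAll.All (_∈ L) w

  arrangement? : ∀ L {k} → Decidable (Arrangement L {k})
  arrangement? L w = unique? w ×-dec VecAll.all? (_∈? L) w

  Distinct-↭ : ∀ {L M : List (Fin n)} → L ↭ M → Distinct L → Distinct M
  Distinct-↭ p = SetoidPerm.Unique-resp-↭ (setoid (Fin n)) (↭⇒↭ₛ p)

  arrangement-∷ : ∀ {y R L k} → y ∷ R ↭ L → Distinct L →
                  Arrangement R {k} ≐ (Arrangement L ∘ (y ∷_))
  arrangement-∷ {y} {R} {L} y∷R↭L uL with Distinct-↭ (↭-sym y∷R↭L) uL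
  ... | y∉R ∷ _ =
    (λ (u , w⊆R) → VecAll.map (All.lookup y∉R) w⊆R VecAllPairs.∷ u ,
                   ∈-resp-↭ y∷R↭L (here refl) VecAll.∷
                   VecAll.map (∈-resp-↭ y∷R↭L ∘ there) w⊆R) ,
    λ { (y∉w VecAllPairs.∷ u , _ VecAll.∷ w⊆L) →
        u , VecAll.map (λ (y≢z , z∈L) → later y≢z (∈-resp-↭ (↭-sym y∷R↭L) z∈L))
                       (VecAll.zip (y∉w , w⊆L)) }
    where
    later : ∀ {z} → y ≢ z → z ∈ y ∷ R → z ∈ R
    later y≢z (here z≡y)  = contradiction (sym z≡y) y≢z
    later y≢z (there z∈R) = z∈R

  -- Two duplicate-free lists with the same members are permutations of each other; here they are
  -- `L` and the part of `allFin n` lying in `L`.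
  sumOver-allFin : ∀ {L} {f : Fin n → ℤ} → Distinct L → (∀ a → a ∉ L → f a ≡ 0ℤ) →
                   sumOver f (allFin n) ≡ sumOver f L
  sumOver-allFin {L} {f} uL vanish = trans
    (sym (sumOver-filter (_∈? L) (allFin n) vanish))
    (sumOver-↭ f (∼bag⇒↭ (unique∧set⇒bag
      (Distinct.filter⁺ (_∈? L) (Distinct.allFin⁺ n)) uL
      (mk⇔ (proj₂ ∘ ∈-filter⁻ (_∈? L) {xs = allFin n}) (∈-filter⁺ (_∈? L) (∈-allFin _))))))

  -- Both sides split by the first letter. A letter outside `L` starts no arrangement; a letter `y`
  -- of `L` leaves the same problem for the list `R` of the others.
  sumOver-arrangements : ∀ k {L} (f : List (Fin n) → ℤ) → Distinct L → length L ≡ k →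
    sumOver (f ∘ toList) (filter (arrangement? L) (words n k)) ≡ permSum f L
  sumOver-arrangements zero    {[]} f uL refl = ℤ.+-identityʳ (f [])
  sumOver-arrangements (suc k) {L} f uL |L|≡1+k = begin
    sumOver (f ∘ toList) (filter (arrangement? L) (words n (suc k)))
      ≡⟨ sumOver-filter-product (arrangement? L) (f ∘ toList) _∷_ (allFin n) (words n k) ⟩
    sumOver startingWith (allFin n)
      ≡⟨ sumOver-allFin uL (λ a a∉L → cong (sumOver (f ∘ (a ∷_) ∘ toList))
           (List.filter-none (arrangement? L ∘ (a ∷_)) {words n k}
             (All.tabulate λ _ arr → a∉L (VecAll.head (proj₂ arr))))) ⟩
    sumOver startingWith L
      ≡⟨ selectSum-sumOver L step ⟨
    selectSum (λ y → permSum (f ∘ (y ∷_))) L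
      ≡⟨ permSum-first f L (λ |L|≡0 → contradiction (trans (sym |L|≡0) |L|≡1+k) λ ()) ⟨
    permSum f L ∎
    where
    open ≡-Reasoning
    startingWith : Fin n → ℤ
    startingWith a =
      sumOver (f ∘ (a ∷_) ∘ toList) (filter (arrangement? L ∘ (a ∷_)) (words n k))
    step : ∀ {y R} → y ∷ R ↭ L → permSum (f ∘ (y ∷_)) R ≡ startingWith y
    step {y} {R} y∷R↭L with Distinct-↭ (↭-sym y∷R↭L) uL
    ... | _ ∷ uR = trans
      (sym (sumOver-arrangements k (f ∘ (y ∷_)) uR
        (ℕ.suc-injective (trans (↭-length y∷R↭L) |L|≡1+k))))
      (cong (sumOver (f ∘ (y ∷_) ∘ toList))
        (List.filter-≐ (arrangement? R) (arrangement? L ∘ (y ∷_))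
          (arrangement-∷ y∷R↭L uL) (words n k)))

sumOver-𝒮 : ∀ n {L} (f : List (Fin n) → ℤ) → Distinct L → length L ≡ n → (∀ a → a ∈ L) →
            sumOver (f ∘ toList) (𝒮 n) ≡ permSum f L
sumOver-𝒮 n {L} f uL |L|≡n full = trans
  (cong (sumOver (f ∘ toList)) (List.filter-≐ unique? (arrangement? L)
    ((λ u → u , VecAll.universal full _) , proj₁) (words n n)))
  (sumOver-arrangements n f uL |L|≡n)

-- Border numbers

-- The effect on a last position of prepending one entry with truth value `b`: a position already
-- found is shifted, otherwise the new entry decides between 1 and 0.
extend : Bool → ℕ → ℕ
extend b     (suc c) = suc (suc c)
extend true  zero    = 1
extend false zero    = 0

-- The last position, counted from 1, at which q holds, or 0 if there is none.
lastTrue : ∀ {k} → (Fin k → Bool) → ℕ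
lastTrue {zero}  q = 0
lastTrue {suc k} q = extend (q fzero) (lastTrue (q ∘ fsuc))

lastTrue-false : ∀ k → lastTrue {k} (const false) ≡ 0
lastTrue-false zero    = refl
lastTrue-false (suc k) = cong (extend false) (lastTrue-false k)

max-∷ : ∀ x xs → max 0 (x ∷ xs) ≡ x ⊔ max 0 xs
max-∷ x xs = ℕ.≤-antisym
  (max≤v⁺ z≤n (ℕ.m≤m⊔n x _ ∷ All.map (λ y≤ → ℕ.≤-trans y≤ (ℕ.m≤n⊔m x _)) (xs≤max 0 xs)))
  (ℕ.⊔-lub (All.head (xs≤max 0 (x ∷ xs))) (max≤v⁺ z≤n (All.tail (xs≤max 0 (x ∷ xs)))))

-- The default 0 of an empty list must not be shifted, whereas a genuine maximum is; hence
-- `extend false` in place of `suc`.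
max-suc : ∀ xs → max 0 (map suc (map suc xs)) ≡ extend false (max 0 (map suc xs))
max-suc []       = refl
max-suc (x ∷ xs) = begin
  max 0 (suc (suc x) ∷ map suc (map suc xs))
    ≡⟨ max-∷ _ (map suc (map suc xs)) ⟩
  suc (suc x) ⊔ max 0 (map suc (map suc xs))
    ≡⟨ cong (suc (suc x) ⊔_) (max-suc xs) ⟩
  suc (suc x) ⊔ extend false (max 0 (map suc xs))
    ≡⟨ ⊔-extend (max 0 (map suc xs)) ⟩
  extend false (suc x ⊔ max 0 (map suc xs))
    ≡⟨ cong (extend false) (max-∷ _ (map suc xs)) ⟨
  extend false (max 0 (suc x ∷ map suc xs)) ∎
  where
  open ≡-Reasoning
  ⊔-extend : ∀ c → suc (suc x) ⊔ extend false c ≡ extend false (suc x ⊔ c)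
  ⊔-extend zero    = refl
  ⊔-extend (suc c) = refl

filter-map-comm : ∀ {P : Pred B 0ℓ} (P? : Decidable P) (f : A → B) xs →
             filter P? (map f xs) ≡ map f (filter (P? ∘ f) xs)
filter-map-comm P? f []       = refl
filter-map-comm P? f (x ∷ xs) with does (P? (f x))
... | true  = cong (f x ∷_) (filter-map-comm P? f xs)
... | false = filter-map-comm P? f xs

max-filter : ∀ {k} {P : Pred (Fin k) 0ℓ} (P? : Decidable P) →
             max 0 (map (suc ∘ toℕ) (filter P? (allFin k))) ≡ lastTrue (does ∘ P?)
max-filter {zero}  P? = refl
max-filter {suc k} P? = begin
  max 0 (positions (filter P? (fzero ∷ tabulate fsuc)))
    ≡⟨ cong (λ xs → max 0 (positions (filter P? (fzero ∷ xs)))) (List.map-tabulate id fsuc) ⟨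
  max 0 (positions (filter P? (fzero ∷ map fsuc (allFin k))))
    ≡⟨ cons ⟩
  extend (does (P? fzero)) (max 0 (positions ys))
    ≡⟨ cong (extend (does (P? fzero))) (max-filter (P? ∘ fsuc)) ⟩
  lastTrue (does ∘ P?) ∎
  where
  open ≡-Reasoning
  ys = filter (P? ∘ fsuc) (allFin k)
  zs = filter P? (map fsuc (allFin k))
  positions : ∀ {j} → List (Fin j) → List ℕ
  positions = map (suc ∘ toℕ)
  toℕ-suc : positions (map fsuc ys) ≡ map suc (map suc (map toℕ ys))
  toℕ-suc = begin
    map (suc ∘ toℕ) (map fsuc ys)     ≡⟨ List.map-∘ ys ⟨
    map (suc ∘ suc ∘ toℕ) ys          ≡⟨ List.map-∘ ys ⟩
    map suc (map (suc ∘ toℕ) ys)      ≡⟨ cong (map suc) (List.map-∘ ys) ⟩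
    map suc (map suc (map toℕ ys))    ∎
  tail : max 0 (positions zs) ≡ extend false (max 0 (positions ys))
  tail = begin
    max 0 (positions zs)
      ≡⟨ cong (max 0 ∘ positions) (filter-map-comm P? fsuc (allFin k)) ⟩
    max 0 (positions (map fsuc ys))
      ≡⟨ cong (max 0) toℕ-suc ⟩
    max 0 (map suc (map suc (map toℕ ys)))
      ≡⟨ max-suc (map toℕ ys) ⟩
    extend false (max 0 (map suc (map toℕ ys)))
      ≡⟨ cong (extend false ∘ max 0) (List.map-∘ ys) ⟨
    extend false (max 0 (positions ys)) ∎
  1⊔ : ∀ c → 1 ⊔ extend false c ≡ extend true c
  1⊔ zero    = refl
  1⊔ (suc c) = refl
  cons : max 0 (positions (filter P? (fzero ∷ map fsuc (allFin k)))) ≡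
         extend (does (P? fzero)) (max 0 (positions ys))
  cons with does (P? fzero)
  ... | false = tail
  ... | true  = begin
    max 0 (1 ∷ positions zs)                  ≡⟨ max-∷ 1 (positions zs) ⟩
    1 ⊔ max 0 (positions zs)                  ≡⟨ cong (1 ⊔_) tail ⟩
    1 ⊔ extend false (max 0 (positions ys))   ≡⟨ 1⊔ (max 0 (positions ys)) ⟩
    extend true (max 0 (positions ys))        ∎

-- The border numbers by recursion on the first letter `y`: borders already found move by one
-- position, and `y` becomes the border, at position 1, of the smaller letters that had none.
-- Arbitrary words over ℕ are allowed so that the factors σ and τ are covered.
borders : List ℕ → List ℕ
borders []      = []
borders (y ∷ π) = 0 ∷ zipWith (λ z → extend (z <ᵇ y)) π (borders π)

border : ∀ {k} → (Fin k → ℕ) → Fin k → ℕ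
border v i = lastTrue (λ m → (toℕ m <ᵇ toℕ i) ∧ (v i <ᵇ v m))

zipWith-tabulate : ∀ (f : A → B → C) {k} (g : Fin k → A) (h : Fin k → B) →
                   tabulate (λ i → f (g i) (h i)) ≡ zipWith f (tabulate g) (tabulate h)
zipWith-tabulate f {zero}  g h = refl
zipWith-tabulate f {suc k} g h = cong (_ ∷_) (zipWith-tabulate f (g ∘ fsuc) (h ∘ fsuc))

tabulate-border : ∀ {k} (v : Fin k → ℕ) → tabulate (border v) ≡ borders (tabulate v)
tabulate-border {zero}  v = refl
tabulate-border {suc k} v = cong₂ _∷_ (lastTrue-false (suc k)) (begin
  tabulate (λ i → extend (v (fsuc i) <ᵇ v fzero) (border (v ∘ fsuc) i))
    ≡⟨ zipWith-tabulate e (v ∘ fsuc) (border (v ∘ fsuc)) ⟩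
  zipWith e (tabulate (v ∘ fsuc)) (tabulate (border (v ∘ fsuc)))
    ≡⟨ cong (zipWith e (tabulate (v ∘ fsuc))) (tabulate-border (v ∘ fsuc)) ⟩
  zipWith e (tabulate (v ∘ fsuc)) (borders (tabulate (v ∘ fsuc))) ∎)
  where
  open ≡-Reasoning
  e = λ z → extend (z <ᵇ v fzero)

tabulate-lookup : ∀ (f : A → B) {k} (v : Vec A k) →
                  tabulate (f ∘ lookup v) ≡ map f (toList v)
tabulate-lookup f []      = refl
tabulate-lookup f (x ∷ v) = cong (f x ∷_) (tabulate-lookup f v)

lbsum-borders : ∀ {n} (π : Vec (Fin n) n) → lbsum π ≡ sum (borders (map toℕ (toList π)))
lbsum-borders {n} π = cong sum (begin
  map (leftBorder π) (allFin n)       ≡⟨ List.map-tabulate id (leftBorder π) ⟩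
  -- The decision procedure inside `leftBorder` computes to the Boolean test inside `border`, so
  -- `max-filter` applies as it stands.
  tabulate (leftBorder π)             ≡⟨ List.tabulate-cong (λ i → max-filter {n} _) ⟩
  tabulate (border (toℕ ∘ lookup π))  ≡⟨ tabulate-border (toℕ ∘ lookup π) ⟩
  borders (tabulate (toℕ ∘ lookup π)) ≡⟨ cong borders (tabulate-lookup toℕ π) ⟩
  borders (map toℕ (toList π))        ∎)
  where open ≡-Reasoning

length-borders : ∀ π → length (borders π) ≡ length π
length-borders []      = refl
length-borders (y ∷ π) = cong suc (begin
  length (zipWith _ π (borders π))      ≡⟨ List.length-zipWith _ π (borders π) ⟩
  length π ℕ.⊓ length (borders π)       ≡⟨ cong (length π ℕ.⊓_) (length-borders π) ⟩
  length π ℕ.⊓ length π                 ≡⟨ ℕ.⊓-idem (length π) ⟩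
  length π                              ∎)
  where open ≡-Reasoning

zipWith-++ : ∀ (f : A → B → C) xs {xs′} ys ys′ → length xs′ ≡ length xs →
             zipWith f (xs ++ ys) (xs′ ++ ys′) ≡ zipWith f xs xs′ ++ zipWith f ys ys′
zipWith-++ f []       {[]}     ys ys′ _  = refl
zipWith-++ f (x ∷ xs) {_ ∷ _}  ys ys′ eq =
  cong (_ ∷_) (zipWith-++ f xs ys ys′ (ℕ.suc-injective eq))

<ᵇ-true : ∀ {m n} → m < n → (m <ᵇ n) ≡ true
<ᵇ-true m<n = dec-true (_ ℕ.<? _) m<n

<ᵇ-false : ∀ {m n} → n < m → (m <ᵇ n) ≡ false
<ᵇ-false n<m = dec-false (_ ℕ.<? _) (ℕ.<-asym n<m)

zipWith-extend-true : ∀ {x} τ cs → All (_< x) τ → length cs ≡ length τ →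
                      zipWith (λ z → extend (z <ᵇ x)) τ cs ≡ map suc cs
zipWith-extend-true []      []       _          _  = refl
zipWith-extend-true {x} (z ∷ τ) (c ∷ cs) (z<x ∷ τ<x) eq = cong₂ _∷_
  (trans (cong (λ b → extend b c) (<ᵇ-true z<x)) (extend-true c))
  (zipWith-extend-true τ cs τ<x (ℕ.suc-injective eq))
  where
  extend-true : ∀ c → extend true c ≡ suc c
  extend-true zero    = refl
  extend-true (suc c) = refl

-- A positive border is shifted whatever the comparison says. So once `x` stands before τ, letters
-- placed further left affect τ only through their number.
zipWith-extend-suc : ∀ (b : A → Bool) τ k cs → length cs ≡ length τ →
                     zipWith (λ z → extend (b z)) τ (map (suc k ℕ.+_) cs) ≡
                     map (suc (suc k) ℕ.+_) cs
zipWith-extend-suc b []      k []       _  = refl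
zipWith-extend-suc b (z ∷ τ) k (c ∷ cs) eq =
  cong (_ ∷_) (zipWith-extend-suc b τ k cs (ℕ.suc-injective eq))

borders-max : ∀ {x} σ τ → All (_< x) σ → All (_< x) τ →
              borders (σ ++ x ∷ τ) ≡ borders σ ++ 0 ∷ map (suc (length σ) ℕ.+_) (borders τ)
borders-max []      τ _ τ<x =
  cong (0 ∷_) (zipWith-extend-true τ (borders τ) τ<x (length-borders τ))
borders-max {x} (y ∷ σ) τ (y<x ∷ σ<x) τ<x = cong (0 ∷_) (begin
  zipWith e (σ ++ x ∷ τ) (borders (σ ++ x ∷ τ))
    ≡⟨ cong (zipWith e (σ ++ x ∷ τ)) (borders-max σ τ σ<x τ<x) ⟩
  zipWith e (σ ++ x ∷ τ) (borders σ ++ 0 ∷ map (suc (length σ) ℕ.+_) (borders τ))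
    ≡⟨ zipWith-++ e σ (x ∷ τ) _ (length-borders σ) ⟩
  zipWith e σ (borders σ) ++ e x 0 ∷ zipWith e τ (map (suc (length σ) ℕ.+_) (borders τ))
    -- As `y` is smaller than `x`, the border 0 of `x` remains 0.
    ≡⟨ cong (zipWith e σ (borders σ) ++_) (cong₂ _∷_ (cong (λ b → extend b 0) (<ᵇ-false y<x))
         (zipWith-extend-suc (_<ᵇ y) τ (length σ) (borders τ) (length-borders τ))) ⟩
  zipWith e σ (borders σ) ++ 0 ∷ map (suc (suc (length σ)) ℕ.+_) (borders τ) ∎)
  where
  open ≡-Reasoning
  e = λ z → extend (z <ᵇ y)

sum-map-+ : ∀ k xs → sum (map (k ℕ.+_) xs) ≡ length xs ℕ.* k ℕ.+ sum xs
sum-map-+ k []       = refl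
sum-map-+ k (x ∷ xs) = trans (cong (k ℕ.+ x ℕ.+_) (sum-map-+ k xs))
                             (rearrange k x (length xs ℕ.* k) (sum xs))
  where
  rearrange : ∀ a b c d → a ℕ.+ b ℕ.+ (c ℕ.+ d) ≡ a ℕ.+ c ℕ.+ (b ℕ.+ d)
  rearrange = ℕSolver.solve-∀

sum-borders-max : ∀ {x} σ τ → All (_< x) σ → All (_< x) τ →
  sum (borders (σ ++ x ∷ τ)) ≡
  sum (borders σ) ℕ.+ (length τ ℕ.* suc (length σ) ℕ.+ sum (borders τ))
sum-borders-max {x} σ τ σ<x τ<x = begin
  sum (borders (σ ++ x ∷ τ))
    ≡⟨ cong sum (borders-max σ τ σ<x τ<x) ⟩
  sum (borders σ ++ 0 ∷ map (suc (length σ) ℕ.+_) (borders τ))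
    ≡⟨ sum-++ (borders σ) _ ⟩
  sum (borders σ) ℕ.+ sum (map (suc (length σ) ℕ.+_) (borders τ))
    ≡⟨ cong (sum (borders σ) ℕ.+_) (sum-map-+ (suc (length σ)) (borders τ)) ⟩
  sum (borders σ) ℕ.+ (length (borders τ) ℕ.* suc (length σ) ℕ.+ sum (borders τ))
    ≡⟨ cong (λ l → sum (borders σ) ℕ.+ (l ℕ.* suc (length σ) ℕ.+ sum (borders τ)))
         (length-borders τ) ⟩
  _ ∎
  where open ≡-Reasoning

-- The signed sums

weight : List ℕ → ℤ
weight π = sgn (parity (sum (borders π)))

-- In decreasing order the head is the largest letter, so it is the one inserted into a complete
-- permutation of the others, as `weight-max` requires.
signedSum : ℕ → ℤ
signedSum n = permSum weight (downFrom n)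

-- The sign (-1)^(j (i + 1)) in terms of the parities of i + j and j. If i + j is even, then i and j
-- have equal parity and j (j + 1) is even; if it is odd, then i + 1 and j have equal parity and the
-- exponent is j² ≡ j modulo 2.
twist : Parity → Parity → ℤ
twist 0ℙ q = 1ℤ
twist 1ℙ q = sgn q

sgn-twist : ∀ p q → sgn (q ℙ.* (p ℙ.⁻¹)) ≡ twist (p ℙ.+ q) q
sgn-twist 0ℙ 0ℙ = refl
sgn-twist 0ℙ 1ℙ = refl
sgn-twist 1ℙ 0ℙ = refl
sgn-twist 1ℙ 1ℙ = refl

sgn-parity-+ : ∀ m n → sgn (parity (m ℕ.+ n)) ≡ sgn (parity m) * sgn (parity n)
sgn-parity-+ m n = trans (cong sgn (ℙ.+-homo-+ m n)) (sgn-homo (parity m) (parity n))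

sgn-parity-* : ∀ m n → sgn (parity (n ℕ.* suc m)) ≡ twist (parity (m ℕ.+ n)) (parity n)
sgn-parity-* m n = begin
  sgn (parity (n ℕ.* suc m))              ≡⟨ cong sgn (ℙ.*-homo-* n (suc m)) ⟩
  sgn (parity n ℙ.* parity (suc m))       ≡⟨ cong (λ p → sgn (parity n ℙ.* p)) (parity-suc m) ⟩
  sgn (parity n ℙ.* (parity m ℙ.⁻¹))      ≡⟨ sgn-twist (parity m) (parity n) ⟩
  twist (parity m ℙ.+ parity n) (parity n) ≡⟨ cong (λ p → twist p (parity n)) (ℙ.+-homo-+ m n) ⟨
  twist (parity (m ℕ.+ n)) (parity n)     ∎
  where open ≡-Reasoning

weight-max : ∀ {x} σ τ → All (_< x) (σ ++ τ) →
  weight (σ ++ x ∷ τ) ≡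
  weight σ * (twist (parity (length (σ ++ τ))) (parity (length τ)) * weight τ)
weight-max {x} σ τ σ++τ<x = begin
  weight (σ ++ x ∷ τ)
    ≡⟨ cong (sgn ∘ parity) (sum-borders-max σ τ (All.++⁻ˡ σ σ++τ<x) (All.++⁻ʳ σ σ++τ<x)) ⟩
  sgn (parity (sum (borders σ) ℕ.+ (length τ ℕ.* suc (length σ) ℕ.+ sum (borders τ))))
    ≡⟨ sgn-parity-+ (sum (borders σ)) _ ⟩
  weight σ * sgn (parity (length τ ℕ.* suc (length σ) ℕ.+ sum (borders τ)))
    ≡⟨ cong (weight σ *_) (sgn-parity-+ (length τ ℕ.* suc (length σ)) _) ⟩
  weight σ * (sgn (parity (length τ ℕ.* suc (length σ))) * weight τ)
    ≡⟨ cong (λ s → weight σ * (s * weight τ)) (sgn-parity-* (length σ) (length τ)) ⟩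
  weight σ * (twist (parity (length σ ℕ.+ length τ)) (parity (length τ)) * weight τ)
    ≡⟨ cong (λ l → weight σ * (twist (parity l) (parity (length τ)) * weight τ))
         (List.length-++ σ) ⟨
  weight σ * (twist (parity (length (σ ++ τ))) (parity (length τ)) * weight τ) ∎
  where open ≡-Reasoning

-- The sign depends on i only through m = i + j, so for fixed `m` it can be absorbed into the second
-- factor of a product of series.
recurrence : ℕ → ℤ
recurrence m = (signedSum ⊙ λ n → twist (parity m) (parity n) * signedSum n) m

permSum-weight-max : ∀ {x L} → All (_< x) L →
  (∀ {M} → M ⊆ L → permSum weight M ≡ signedSum (length M)) →
  permSum weight (x ∷ L) ≡ recurrence (length L)
permSum-weight-max {x} {L} L<x sums = begin
  permSum (insertSum x weight) L
    ≡⟨ permSum-cong L (λ π π↭L → insertSum-factor π λ σ τ σ++τ≡π → trans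
         (weight-max σ τ (subst (All (_< x)) (sym σ++τ≡π) (All-resp-↭ (↭-sym π↭L) L<x)))
         -- Every `π` has the length of `L`, so the first argument of `twist` becomes constant over
         -- the sum.
         (cong (λ l → weight σ * (twist (parity l) (parity (length τ)) * weight τ))
               (trans (cong length σ++τ≡π) (↭-length π↭L)))) ⟩
  permSum (weight ⋆ twisted) L
    ≡⟨ permSum-⋆ L sums twistedSums ⟩
  recurrence (length L) ∎
  where
  open ≡-Reasoning
  p = parity (length L)
  twisted = λ τ → twist p (parity (length τ)) * weight τ
  twistedSums : ∀ {M} → M ⊆ L →
                permSum twisted M ≡ twist p (parity (length M)) * signedSum (length M)
  twistedSums {M} M⊆L = begin
    permSum twisted M
      ≡⟨ permSum-cong M (λ τ τ↭M → cong (λ l → twist p (parity l) * weight τ) (↭-length τ↭M)) ⟩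
    permSum (λ τ → twist p (parity (length M)) * weight τ) M
      ≡⟨ permSum-*ˡ (twist p (parity (length M))) weight M ⟩
    twist p (parity (length M)) * permSum weight M
      ≡⟨ cong (twist p (parity (length M)) *_) (sums M⊆L) ⟩
    twist p (parity (length M)) * signedSum (length M) ∎

AllPairs-resp-⊆ : ∀ {R : A → A → Set} {L M} → M ⊆ L → AllPairs R L → AllPairs R M
AllPairs-resp-⊆ []             []       = []
AllPairs-resp-⊆ (_ ∷ʳ M⊆L)     (_ ∷ rs) = AllPairs-resp-⊆ M⊆L rs
AllPairs-resp-⊆ (refl ∷ M⊆L)   (r ∷ rs) = All-resp-⊆ M⊆L r ∷ AllPairs-resp-⊆ M⊆L rs

downFrom-descending : ∀ n → AllPairs _>_ (downFrom n)
downFrom-descending n = applyDownFrom⁺₁ id n (λ j<i _ → j<i)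

-- Independence of the actual letters, in place of standardisation: `L` and the `downFrom` list of
-- the same length expand by the same `recurrence`. The bound `n` carries the recursion, since the
-- sublists met in it are not structural subterms.
permSum-weight-≤ : ∀ n {L} → length L ≤ n → AllPairs _>_ L →
                   permSum weight L ≡ signedSum (length L)
permSum-weight-≤ n       {[]}    _           _          = refl
permSum-weight-≤ (suc n) {x ∷ L} (s≤s |L|≤n) (L<x ∷ L↘) = begin
  permSum weight (x ∷ L)
    ≡⟨ expand L<x L↘ |L|≤n ⟩
  recurrence (length L)
    ≡⟨ cong recurrence (List.length-downFrom (length L)) ⟨
  recurrence (length (downFrom (length L)))
    ≡⟨ expand-downFrom (downFrom-descending (suc (length L))) ⟨
  signedSum (suc (length L)) ∎
  where
  open ≡-Reasoning
  expand : ∀ {x M} → All (_< x) M → AllPairs _>_ M → length M ≤ n →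
           permSum weight (x ∷ M) ≡ recurrence (length M)
  expand M<x M↘ |M|≤n = permSum-weight-max M<x λ K⊆M →
    permSum-weight-≤ n (ℕ.≤-trans (length-mono-≤ K⊆M) |M|≤n) (AllPairs-resp-⊆ K⊆M M↘)
  expand-downFrom : AllPairs _>_ (downFrom (suc (length L))) →
    signedSum (suc (length L)) ≡ recurrence (length (downFrom (length L)))
  expand-downFrom (M<x ∷ M↘) = expand M<x M↘
    (subst (_≤ n) (sym (List.length-downFrom (length L))) |L|≤n)

signedSum-suc : ∀ m → signedSum (suc m) ≡ recurrence m
signedSum-suc m with downFrom-descending (suc m)
... | M<m ∷ M↘ = trans
  (permSum-weight-max M<m λ K⊆M → permSum-weight-≤ _ ℕ.≤-refl (AllPairs-resp-⊆ K⊆M M↘))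
  (cong recurrence (List.length-downFrom m))

signedSum-odd : ∀ {m} → parity m ≡ 0ℙ → signedSum (suc m) ≡ (signedSum ⊙ signedSum) m
signedSum-odd {m} even = begin
  signedSum (suc m)
    ≡⟨ signedSum-suc m ⟩
  (signedSum ⊙ λ n → twist (parity m) (parity n) * signedSum n) m
    ≡⟨ ⊙-congˡ m (λ n → cong (λ p → twist p (parity n) * signedSum n) even) ⟩
  (signedSum ⊙ λ n → 1ℤ * signedSum n) m
    ≡⟨ ⊙-congˡ m (λ n → ℤ.*-identityˡ (signedSum n)) ⟩
  (signedSum ⊙ signedSum) m ∎
  where open ≡-Reasoning

i≡-i⇒i≡0 : ∀ {i} → i ≡ - i → i ≡ 0ℤ
i≡-i⇒i≡0 {+ zero}   _ = refl
i≡-i⇒i≡0 {+ suc _}  ()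
i≡-i⇒i≡0 { -[1+ _ ]} ()

sgn-sgn : ∀ p i → sgn p * (sgn p * i) ≡ i
sgn-sgn 0ℙ = solve-∀
sgn-sgn 1ℙ = solve-∀

-- The cancellation of (i, j) against (j, i), stated for series: D(z) D(-z) is invariant under z ↦
-- -z, so each odd coefficient equals its own negative.
signedSum-even : ∀ {m} → parity m ≡ 1ℙ → signedSum (suc m) ≡ 0ℤ
signedSum-even {m} odd = trans
  (trans (signedSum-suc m)
         (⊙-congˡ m (λ n → cong (λ p → twist p (parity n) * signedSum n) odd)))
  (i≡-i⇒i≡0 (begin
    (signedSum ⊙ alternate signedSum) m
      ≡⟨ ⊙-comm signedSum (alternate signedSum) m ⟩
    (alternate signedSum ⊙ signedSum) m
      ≡⟨ ⊙-congˡ m (λ n → sym (sgn-sgn (parity n) (signedSum n))) ⟩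
    (alternate signedSum ⊙ alternate (alternate signedSum)) m
      ≡⟨ alternate-⊙ signedSum (alternate signedSum) m ⟩
    sgn (parity m) * (signedSum ⊙ alternate signedSum) m
      ≡⟨ cong (λ p → sgn p * (signedSum ⊙ alternate signedSum) m) odd ⟩
    - 1ℤ * (signedSum ⊙ alternate signedSum) m
      ≡⟨ ℤ.-1*i≡-i _ ⟩
    - (signedSum ⊙ alternate signedSum) m ∎))
  where open ≡-Reasoning

-- Removes the absolute value from the theorem. Strong induction bounded by `n`: a value at an odd
-- argument is a coefficient of the square of the series, built from earlier values.
signedSum-nonNeg : ∀ n k → k ≤ n → 0ℤ ℤ.≤ signedSum k
signedSum-nonNeg n       zero    _         = ℤ.+≤+ z≤n
signedSum-nonNeg (suc n) (suc m) (s≤s m≤n) with parity m in eq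
... | 0ℙ = subst (0ℤ ℤ.≤_) (sym (signedSum-odd {m} eq))
             (⊙-nonNeg m (λ k k≤m → signedSum-nonNeg n k (ℕ.≤-trans k≤m m≤n))
                         (λ k k≤m → signedSum-nonNeg n k (ℕ.≤-trans k≤m m≤n)))
... | 1ℙ = ℤ.≤-reflexive (sym (signedSum-even {m} eq))

-- The odd part and its differential equation

oddPart : ℕ → ℤ
oddPart zero    = 0ℤ
oddPart (suc n) = signedSum (suc n)

-- Only the value at 0 has to be split off to leave an odd series, since `signedSum` vanishes at the
-- positive even arguments.
signedSum≗1+oddPart : signedSum ≗ λ n → one n + oddPart n
signedSum≗1+oddPart zero    = refl
signedSum≗1+oddPart (suc n) = sym (ℤ.+-identityˡ (signedSum (suc n)))

parity-pred : ∀ {m p} → parity (suc m) ≡ p → parity m ≡ p ℙ.⁻¹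
parity-pred {m} eq = trans (sym (ℙ.suc-homo-⁻¹ m)) (cong ℙ._⁻¹ eq)

oddPart-even : ∀ n → parity n ≡ 0ℙ → oddPart n ≡ 0ℤ
oddPart-even zero    _    = refl
oddPart-even (suc m) even = signedSum-even {m} (parity-pred {m} even)

alternate-oddPart : ∀ n → alternate oddPart n ≡ - oddPart n
alternate-oddPart n with parity n in eq
... | 0ℙ rewrite oddPart-even n eq = refl
... | 1ℙ = ℤ.-1*i≡-i (oddPart n)

oddPart²-odd : ∀ m → parity m ≡ 1ℙ → (oddPart ⊙ oddPart) m ≡ 0ℤ
oddPart²-odd m odd = i≡-i⇒i≡0 (begin
  (oddPart ⊙ oddPart) m
    ≡⟨ ℤ.neg-involutive _ ⟨
  - - (oddPart ⊙ oddPart) m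
    ≡⟨ cong -_ (⊙-negʳ oddPart oddPart m) ⟨
  - (oddPart ⊙ (-_ ∘ oddPart)) m
    ≡⟨ ⊙-negˡ oddPart (-_ ∘ oddPart) m ⟨
  ((-_ ∘ oddPart) ⊙ (-_ ∘ oddPart)) m
    ≡⟨ ⊙-cong m (λ k _ → alternate-oddPart k) (λ k _ → alternate-oddPart k) ⟨
  (alternate oddPart ⊙ alternate oddPart) m
    ≡⟨ alternate-⊙ oddPart oddPart m ⟩
  sgn (parity m) * (oddPart ⊙ oddPart) m
    ≡⟨ cong (λ p → sgn p * (oddPart ⊙ oddPart) m) odd ⟩
  - 1ℤ * (oddPart ⊙ oddPart) m
    ≡⟨ ℤ.-1*i≡-i _ ⟩
  - (oddPart ⊙ oddPart) m ∎)
  where open ≡-Reasoning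

one-odd : ∀ m → parity m ≡ 1ℙ → one m ≡ 0ℤ
one-odd zero    ()
one-odd (suc m) _  = refl

-- At even `m` the recurrence gives the coefficient of (1 + y)² = 1 + 2y + y², where 2y contributes
-- nothing because y is odd. At odd `m` both sides vanish, y² being even.
oddPart-suc : ∀ m → oddPart (suc m) ≡ one m + (oddPart ⊙ oddPart) m
oddPart-suc m with parity m in eq
... | 1ℙ = trans (signedSum-even {m} eq) (sym (cong₂ _+_ (one-odd m eq) (oddPart²-odd m eq)))
... | 0ℙ = begin
  signedSum (suc m)
    ≡⟨ signedSum-odd {m} eq ⟩
  (signedSum ⊙ signedSum) m
    ≡⟨ ⊙-cong m (λ k _ → signedSum≗1+oddPart k) (λ k _ → signedSum≗1+oddPart k) ⟩
  (1+y ⊙ 1+y) m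
    ≡⟨ ⊙-distribʳ-+ 1+y one oddPart m ⟩
  (one ⊙ 1+y) m + (oddPart ⊙ 1+y) m
    ≡⟨ cong₂ _+_ (⊙-identityˡ 1+y m) (⊙-distribˡ-+ oddPart one oddPart m) ⟩
  one m + oddPart m + ((oddPart ⊙ one) m + (oddPart ⊙ oddPart) m)
    ≡⟨ cong (λ t → one m + oddPart m + (t + (oddPart ⊙ oddPart) m))
         (trans (⊙-comm oddPart one m) (⊙-identityˡ oddPart m)) ⟩
  one m + oddPart m + (oddPart m + (oddPart ⊙ oddPart) m)
    ≡⟨ cong (λ t → one m + t + (t + (oddPart ⊙ oddPart) m)) (oddPart-even m eq) ⟩
  one m + 0ℤ + (0ℤ + (oddPart ⊙ oddPart) m)
    ≡⟨ cong₂ _+_ (ℤ.+-identityʳ (one m)) (ℤ.+-identityˡ ((oddPart ⊙ oddPart) m)) ⟩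
  one m + (oddPart ⊙ oddPart) m ∎
  where
  open ≡-Reasoning
  1+y = λ n → one n + oddPart n

sin-suc : ∀ n → sin⁽ suc n ⁾ ≡ cos⁽ n ⁾
sin-suc zero          = refl
sin-suc (suc zero)    = refl
sin-suc (suc (suc n)) = cong -_ (sin-suc n)

cos-suc : ∀ n → cos⁽ suc n ⁾ ≡ - sin⁽ n ⁾
cos-suc zero          = refl
cos-suc (suc zero)    = refl
cos-suc (suc (suc n)) = cong -_ (cos-suc n)

-- y is a solution of y′ = 1 + y² with y(0) = 0.  Then u = y cos − sin satisfies
-- the homogeneous linear equation u′ = y u with u(0) = 0, hence vanishes.
module Tangent (y : ℕ → ℤ) (y-zero : y 0 ≡ 0ℤ)
               (y-suc : ∀ m → y (suc m) ≡ one m + (y ⊙ y) m) where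
  c s u : ℕ → ℤ
  c = cos⁽_⁾
  s = sin⁽_⁾
  u n = (y ⊙ c) n + - s n

  -- u′ = y′ cos - y sin - cos; inserting y′ = 1 + y² cancels cos and leaves y (y cos - sin).
  u-suc : ∀ n → u (suc n) ≡ (y ⊙ u) n
  u-suc n = begin
    (y ∘ suc ⊙ c) n + (y ⊙ c ∘ suc) n + - s (suc n)
      ≡⟨ cong₂ (λ a b → a + b + - s (suc n)) (⊙-congʳ n y-suc) (⊙-congˡ n cos-suc) ⟩
    ((λ k → one k + (y ⊙ y) k) ⊙ c) n + (y ⊙ (-_ ∘ s)) n + - s (suc n)
      ≡⟨ cong₂ (λ a b → a + (y ⊙ (-_ ∘ s)) n + - b) (⊙-distribʳ-+ c one (y ⊙ y) n) (sin-suc n) ⟩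
    (one ⊙ c) n + ((y ⊙ y) ⊙ c) n + (y ⊙ (-_ ∘ s)) n + - c n
      ≡⟨ cong₂ (λ a b → a + b + (y ⊙ (-_ ∘ s)) n + - c n) (⊙-identityˡ c n) (⊙-assoc y y c n) ⟩
    c n + (y ⊙ (y ⊙ c)) n + (y ⊙ (-_ ∘ s)) n + - c n
      ≡⟨ cancel (c n) ((y ⊙ (y ⊙ c)) n) ((y ⊙ (-_ ∘ s)) n) ⟩
    (y ⊙ (y ⊙ c)) n + (y ⊙ (-_ ∘ s)) n
      ≡⟨ ⊙-distribˡ-+ y (y ⊙ c) (-_ ∘ s) n ⟨
    (y ⊙ u) n ∎
    where
    open ≡-Reasoning
    cancel : ∀ a b d → a + b + d + - a ≡ b + d
    cancel = solve-∀

  -- Uniqueness for the linear equation, coefficientwise: `u (suc k)` is determined by the values of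
  -- `u` up to `k`, all of them 0.
  u≡0 : ∀ n k → k ≤ n → u k ≡ 0ℤ
  u≡0 n       zero    _         = cong (λ t → t * 1ℤ + 0ℤ) y-zero
  u≡0 (suc n) (suc k) (s≤s k≤n) = begin
    u (suc k)            ≡⟨ u-suc k ⟩
    (y ⊙ u) k            ≡⟨ ⊙-cong k (λ _ _ → refl) (λ j j≤k → u≡0 n j (ℕ.≤-trans j≤k k≤n)) ⟩
    (y ⊙ const 0ℤ) k     ≡⟨ ⊙-zeroʳ y k ⟩
    0ℤ                   ∎
    where open ≡-Reasoning

  ⊙-cos : y ⊙ c ≗ s
  ⊙-cos n = ℤ.i-j≡0⇒i≡j ((y ⊙ c) n) (s n) (u≡0 n n ℕ.≤-refl)

-- Rational power series

/-cross : ∀ p q m n .{{_ : NonZero m}} .{{_ : NonZero n}} →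
          p ℤ.* + n ≡ q ℤ.* + m → p / m ≡ q / n
/-cross p q (suc m) (suc n) eq = ℚ.fromℚᵘ-cong {mkℚᵘ p m} {mkℚᵘ q n} (*≡* eq)

-- Since `_/_` reduces to lowest terms, the identity is verified on unnormalised fractions, where
-- the product has the required form by computation.
/-* : ∀ p q m n .{{_ : NonZero m}} .{{_ : NonZero n}} .{{_ : NonZero (m ℕ.* n)}} →
      (p / m) ℚ.* (q / n) ≡ (p ℤ.* q) / (m ℕ.* n)
/-* p q (suc m) (suc n) = ℚ.toℚᵘ-injective (begin
  ℚ.toℚᵘ ((p / suc m) ℚ.* (q / suc n))
    ≈⟨ ℚ.toℚᵘ-homo-* (p / suc m) (q / suc n) ⟩
  ℚ.toℚᵘ (p / suc m) ℚᵘ.* ℚ.toℚᵘ (q / suc n)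
    ≈⟨ ℚᵘ.*-cong (ℚ.toℚᵘ-fromℚᵘ (mkℚᵘ p m)) (ℚ.toℚᵘ-fromℚᵘ (mkℚᵘ q n)) ⟩
  mkℚᵘ p m ℚᵘ.* mkℚᵘ q n
    ≈⟨ ℚ.toℚᵘ-fromℚᵘ (mkℚᵘ (p ℤ.* q) (n ℕ.+ m ℕ.* suc n)) ⟨
  ℚ.toℚᵘ ((p ℤ.* q) / (suc m ℕ.* suc n)) ∎)
  where open import Relation.Binary.Reasoning.Setoid ℚᵘ.≃-setoid

/-+ : ∀ p q n .{{_ : NonZero n}} → (p / n) ℚ.+ (q / n) ≡ (p ℤ.+ q) / n
/-+ p q (suc n) = ℚ.toℚᵘ-injective (begin
  ℚ.toℚᵘ ((p / suc n) ℚ.+ (q / suc n))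
    ≈⟨ ℚ.toℚᵘ-homo-+ (p / suc n) (q / suc n) ⟩
  ℚ.toℚᵘ (p / suc n) ℚᵘ.+ ℚ.toℚᵘ (q / suc n)
    ≈⟨ ℚᵘ.+-cong (ℚ.toℚᵘ-fromℚᵘ (mkℚᵘ p n)) (ℚ.toℚᵘ-fromℚᵘ (mkℚᵘ q n)) ⟩
  mkℚᵘ p n ℚᵘ.+ mkℚᵘ q n
    ≈⟨ *≡* (distrib p q (+ suc n)) ⟩
  mkℚᵘ (p ℤ.+ q) n
    ≈⟨ ℚ.toℚᵘ-fromℚᵘ (mkℚᵘ (p ℤ.+ q) n) ⟨
  ℚ.toℚᵘ ((p ℤ.+ q) / suc n) ∎)
  where
  open import Relation.Binary.Reasoning.Setoid ℚᵘ.≃-setoid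
  distrib : ∀ p q d → (p ℤ.* d ℤ.+ q ℤ.* d) ℤ.* d ≡ (p ℤ.+ q) ℤ.* (d ℤ.* d)
  distrib = solve-∀

infix 8 ι_
ι_ : ℕ → ℚ
ι n = + n / 1

ι-* : ∀ k p n .{{_ : NonZero n}} .{{_ : NonZero (k ℕ.* n)}} → ι k ℚ.* (p / (k ℕ.* n)) ≡ p / n
ι-* k p n = trans (/-* (+ k) p 1 (k ℕ.* n) {{_}} {{_}} {{ℕ.m*n≢0 1 (k ℕ.* n)}})
  (/-cross (+ k ℤ.* p) p (1 ℕ.* (k ℕ.* n)) n {{ℕ.m*n≢0 1 (k ℕ.* n)}} (begin
    + k ℤ.* p ℤ.* + n            ≡⟨ rearrange (+ k) p (+ n) ⟩
    p ℤ.* (+ k ℤ.* + n)          ≡⟨ cong (p ℤ.*_) (ℤ.pos-* k n) ⟨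
    p ℤ.* + (k ℕ.* n)            ≡⟨ cong (λ t → p ℤ.* + t) (ℕ.*-identityˡ (k ℕ.* n)) ⟨
    p ℤ.* + (1 ℕ.* (k ℕ.* n))    ∎))
  where
  open ≡-Reasoning
  rearrange : ∀ k p n → k ℤ.* p ℤ.* n ≡ p ℤ.* (k ℤ.* n)
  rearrange = solve-∀

ι-cancelˡ : ∀ k .{{_ : NonZero k}} {x y} → ι k ℚ.* x ≡ ι k ℚ.* y → x ≡ y
ι-cancelˡ k {{k≢0}} {x} {y} eq = begin
  x                          ≡⟨ undo x ⟨
  (1ℤ / k) ℚ.* (ι k ℚ.* x)   ≡⟨ cong ((1ℤ / k) ℚ.*_) eq ⟩
  (1ℤ / k) ℚ.* (ι k ℚ.* y)   ≡⟨ undo y ⟩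
  y                          ∎
  where
  open ≡-Reasoning
  inverse : (1ℤ / k) ℚ.* ι k ≡ 1ℚ
  inverse = trans (/-* 1ℤ (+ k) k 1 {{k≢0}} {{_}} {{ℕ.m*n≢0 k 1}})
    (/-cross (1ℤ ℤ.* + k) 1ℤ (k ℕ.* 1) 1 {{ℕ.m*n≢0 k 1}}
      (trans (ℤ.*-identityʳ (1ℤ ℤ.* + k)) (cong (λ t → 1ℤ ℤ.* + t) (sym (ℕ.*-identityʳ k)))))
  undo : ∀ z → (1ℤ / k) ℚ.* (ι k ℚ.* z) ≡ z
  undo z = trans (sym (ℚ.*-assoc (1ℤ / k) (ι k) z))
                 (trans (cong (ℚ._* z) inverse) (ℚ.*-identityˡ z))

ι-suc : ∀ n → ι (suc n) ≡ 1ℚ ℚ.+ ι n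
ι-suc n = sym (/-+ 1ℤ (+ n) 1)

⊛-cong : ∀ {f f′ g g′} → f ≗ f′ → g ≗ g′ → f ⊛ g ≗ f′ ⊛ g′
⊛-cong f≗f′ g≗g′ zero    = cong₂ (λ a b → a ℚ.* b ℚ.+ 0ℚ) (f≗f′ 0) (g≗g′ 0)
⊛-cong f≗f′ g≗g′ (suc n) = cong₂ ℚ._+_ (cong₂ ℚ._*_ (f≗f′ 0) (g≗g′ (suc n)))
                                        (⊛-cong (f≗f′ ∘ suc) g≗g′ n)

⊛-distribʳ-+ : ∀ f g h n → ((λ k → f k ℚ.+ g k) ⊛ h) n ≡ (f ⊛ h) n ℚ.+ (g ⊛ h) n
⊛-distribʳ-+ f g h zero    =
  solve 3 (λ a b c → (a :+ b) :* c :+ con 0ℚ := (a :* c :+ con 0ℚ) :+ (b :* c :+ con 0ℚ))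
    refl (f 0) (g 0) (h 0)
⊛-distribʳ-+ f g h (suc n) = trans
  (cong ((f 0 ℚ.+ g 0) ℚ.* h (suc n) ℚ.+_) (⊛-distribʳ-+ (f ∘ suc) (g ∘ suc) h n))
  (solve 5 (λ a b c d e → (a :+ b) :* c :+ (d :+ e) := (a :* c :+ d) :+ (b :* c :+ e))
    refl (f 0) (g 0) (h (suc n)) ((f ∘ suc ⊛ h) n) ((g ∘ suc ⊛ h) n))

derivative : Series → Series
derivative f n = ι (suc n) ℚ.* f (suc n)

⊛-derivative : ∀ f g n → derivative (f ⊛ g) n ≡ (derivative f ⊛ g) n ℚ.+ (f ⊛ derivative g) n
⊛-derivative f g zero    =
  solve 5 (λ i f₀ f₁ g₀ g₁ →
      i :* (f₀ :* g₁ :+ (f₁ :* g₀ :+ con 0ℚ)) :=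
      (i :* f₁ :* g₀ :+ con 0ℚ) :+ (f₀ :* (i :* g₁) :+ con 0ℚ))
    refl (ι 1) (f 0) (f 1) (g 0) (g 1)
⊛-derivative f g (suc n) = begin
  ι (suc (suc n)) ℚ.* (f 0 ℚ.* g₂ ℚ.+ P)
    ≡⟨ solve 4 (λ i f₀ g₂ p → i :* (f₀ :* g₂ :+ p) := f₀ :* (i :* g₂) :+ i :* p)
         refl (ι (suc (suc n))) (f 0) g₂ P ⟩
  f 0 ℚ.* derivative g (suc n) ℚ.+ ι (suc (suc n)) ℚ.* P
    -- The induction hypothesis for `f ∘ suc` accounts for the factor `suc n` only. The extra copy
    -- of `P` corrects the shift of `f`, by `derivative-tail`.
    ≡⟨ cong (λ i → f 0 ℚ.* derivative g (suc n) ℚ.+ i ℚ.* P) (ι-suc (suc n)) ⟩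
  f 0 ℚ.* derivative g (suc n) ℚ.+ (1ℚ ℚ.+ ι (suc n)) ℚ.* P
    ≡⟨ solve 3 (λ a i p → a :+ (con 1ℚ :+ i) :* p := a :+ (p :+ i :* p))
         refl (f 0 ℚ.* derivative g (suc n)) (ι (suc n)) P ⟩
  f 0 ℚ.* derivative g (suc n) ℚ.+ (P ℚ.+ ι (suc n) ℚ.* P)
    ≡⟨ cong (λ t → f 0 ℚ.* derivative g (suc n) ℚ.+ (P ℚ.+ t)) (⊛-derivative (f ∘ suc) g n) ⟩
  f 0 ℚ.* derivative g (suc n) ℚ.+
    (f 1 ℚ.* g (suc n) ℚ.+ Q ℚ.+ ((derivative (f ∘ suc) ⊛ g) n ℚ.+ (f ∘ suc ⊛ derivative g) n))
    ≡⟨ solve 5 (λ a b q r s → a :+ (b :+ q :+ (r :+ s)) := b :+ (q :+ r) :+ (a :+ s)) refl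
         (f 0 ℚ.* derivative g (suc n)) (f 1 ℚ.* g (suc n)) Q
         ((derivative (f ∘ suc) ⊛ g) n) ((f ∘ suc ⊛ derivative g) n) ⟩
  f 1 ℚ.* g (suc n) ℚ.+ (Q ℚ.+ (derivative (f ∘ suc) ⊛ g) n) ℚ.+ (f ⊛ derivative g) (suc n)
    ≡⟨ cong₂ (λ a b → a ℚ.* g (suc n) ℚ.+ b ℚ.+ (f ⊛ derivative g) (suc n))
         (sym (ℚ.*-identityˡ (f 1)))
         (trans (sym (⊛-distribʳ-+ (f ∘ suc ∘ suc) (derivative (f ∘ suc)) g n))
                (⊛-cong {g = g} derivative-tail (λ _ → refl) n)) ⟩
  (derivative f ⊛ g) (suc n) ℚ.+ (f ⊛ derivative g) (suc n) ∎
  where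
  open ≡-Reasoning
  g₂ P Q : ℚ
  g₂ = g (suc (suc n))
  P = (f ∘ suc ⊛ g) (suc n)
  Q = (f ∘ suc ∘ suc ⊛ g) n
  derivative-tail : ∀ k → f (suc (suc k)) ℚ.+ derivative (f ∘ suc) k ≡ derivative f (suc k)
  derivative-tail k = trans
    (solve 2 (λ i x → x :+ i :* x := (con 1ℚ :+ i) :* x) refl (ι (suc k)) (f (suc (suc k))))
    (cong (ℚ._* f (suc (suc k))) (sym (ι-suc (suc k))))

egf : (ℕ → ℤ) → Series
egf a n = (a n / (n !)) {{n !≢0}}

derivative-egf : ∀ a → derivative (egf a) ≗ egf (a ∘ suc)
derivative-egf a n = ι-* (suc n) (a (suc n)) (n !) {{n !≢0}} {{suc n !≢0}}

-- The coefficients at `suc n` are compared after multiplication by `suc n`, that is, as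
-- coefficients of derivatives: there both products obey the Leibniz rule.
egf-⊙ : ∀ a b → egf a ⊛ egf b ≗ egf (a ⊙ b)
egf-⊙ a b zero    = trans (ℚ.+-identityʳ _) (/-* (a 0) (b 0) 1 1)
egf-⊙ a b (suc n) = ι-cancelˡ (suc n) (begin
  derivative (egf a ⊛ egf b) n
    ≡⟨ ⊛-derivative (egf a) (egf b) n ⟩
  (derivative (egf a) ⊛ egf b) n ℚ.+ (egf a ⊛ derivative (egf b)) n
    ≡⟨ cong₂ ℚ._+_ (⊛-cong {g = egf b} (derivative-egf a) (λ _ → refl) n)
                   (⊛-cong {egf a} (λ _ → refl) (derivative-egf b) n) ⟩
  (egf (a ∘ suc) ⊛ egf b) n ℚ.+ (egf a ⊛ egf (b ∘ suc)) n
    ≡⟨ cong₂ ℚ._+_ (egf-⊙ (a ∘ suc) b n) (egf-⊙ a (b ∘ suc) n) ⟩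
  egf (a ∘ suc ⊙ b) n ℚ.+ egf (a ⊙ b ∘ suc) n
    ≡⟨ /-+ ((a ∘ suc ⊙ b) n) ((a ⊙ b ∘ suc) n) (n !) {{n !≢0}} ⟩
  egf ((a ⊙ b) ∘ suc) n
    ≡⟨ derivative-egf (a ⊙ b) n ⟨
  derivative (egf (a ⊙ b)) n ∎)
  where open ≡-Reasoning

-- In the induction `f` and `h` vary, because each step of the long division passes to the remainder
-- of `f` and to the tail of `h`.
⊘-unique : ∀ f g h → g 0 ≡ 1ℚ → h ⊛ g ≗ f → h ≗ f ⊘ g
⊘-unique f g h g₀≡1 hg≗f n = go n f h hg≗f
  where
  h₀≡f₀ : ∀ f h → h ⊛ g ≗ f → h 0 ≡ f 0
  h₀≡f₀ f h hg≗f = begin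
    h 0                  ≡⟨ ℚ.*-identityʳ (h 0) ⟨
    h 0 ℚ.* 1ℚ           ≡⟨ cong (h 0 ℚ.*_) g₀≡1 ⟨
    h 0 ℚ.* g 0          ≡⟨ ℚ.+-identityʳ (h 0 ℚ.* g 0) ⟨
    h 0 ℚ.* g 0 ℚ.+ 0ℚ   ≡⟨ hg≗f 0 ⟩
    f 0                  ∎
    where open ≡-Reasoning
  go : ∀ n f h → h ⊛ g ≗ f → h n ≡ (f ⊘ g) n
  go zero    f h hg≗f = h₀≡f₀ f h hg≗f
  go (suc n) f h hg≗f = go n _ (h ∘ suc) λ m → begin
    (h ∘ suc ⊛ g) m
      ≡⟨ +-move (h 0 ℚ.* g (suc m)) ((h ∘ suc ⊛ g) m) ⟩
    (h ⊛ g) (suc m) ℚ.- h 0 ℚ.* g (suc m)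
      ≡⟨ cong₂ (λ a b → a ℚ.- b ℚ.* g (suc m)) (hg≗f (suc m)) (h₀≡f₀ f h hg≗f) ⟩
    f (suc m) ℚ.- f 0 ℚ.* g (suc m) ∎
    where
    open ≡-Reasoning
    +-move : ∀ x y → y ≡ (x ℚ.+ y) ℚ.- x
    +-move x y = solve 2 (λ x y → y := (x :+ y) :- x) refl x y

ι-!-egf : ∀ a n → ι (n !) ℚ.* egf a n ≡ a n / 1
ι-!-egf a n = begin
  ι (n !) ℚ.* egf a n              ≡⟨ cong (ι (n !) ℚ.*_) (ℚ./-cong {a n} refl n!≡n!*1) ⟩
  ι (n !) ℚ.* (a n / (n ! ℕ.* 1))  ≡⟨ ι-* (n !) (a n) 1 ⟩
  a n / 1                          ∎
  where
  open ≡-Reasoning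
  n!≡n!*1 = sym (ℕ.*-identityʳ (n !))
  instance
    n!≢0 : NonZero (n !)
    n!≢0 = n !≢0
    n!*1≢0 : NonZero (n ! ℕ.* 1)
    n!*1≢0 = ℕ.m*n≢0 (n !) 1

T-⊙-cos : ∀ y → y ⊙ cos⁽_⁾ ≗ sin⁽_⁾ → ∀ n → T n ≡ y n / 1
T-⊙-cos y y⊙cos≗sin n = trans
  (cong (ι (n !) ℚ.*_) (sym (⊘-unique sin cos (egf y) refl egf-y-cos n)))
  (ι-!-egf y n)
  where
  egf-y-cos : egf y ⊛ cos ≗ sin
  egf-y-cos m = trans (egf-⊙ y cos⁽_⁾ m) (cong (λ t → (t / (m !)) {{m !≢0}}) (y⊙cos≗sin m))

-- From the two counts to the signed sum, and the theorem

sumOver-sgn : ∀ (p : A → Parity) xs → sumOver (sgn ∘ p) xs ≡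
  + length (filter (λ x → p x ℙ.≟ 0ℙ) xs) - + length (filter (λ x → p x ℙ.≟ 1ℙ) xs)
sumOver-sgn p []       = refl
sumOver-sgn p (x ∷ xs) with p x
... | 0ℙ = trans (cong (_+_ 1ℤ) (sumOver-sgn p xs)) (sym (ℤ.+-assoc 1ℤ (+ evens) (- + odds)))
  where
  evens = length (filter (λ x → p x ℙ.≟ 0ℙ) xs)
  odds  = length (filter (λ x → p x ℙ.≟ 1ℙ) xs)
... | 1ℙ = trans (cong (_+_ (- 1ℤ)) (sumOver-sgn p xs)) (rearrange (+ evens) (+ odds))
  where
  evens = length (filter (λ x → p x ℙ.≟ 0ℙ) xs)
  odds  = length (filter (λ x → p x ℙ.≟ 1ℙ) xs)
  rearrange : ∀ a b → - 1ℤ + (a - b) ≡ a - (1ℤ + b)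
  rearrange = solve-∀

tabulate-toℕ : ∀ (f : ℕ → A) n → tabulate {n = n} (f ∘ toℕ) ≡ applyUpTo f n
tabulate-toℕ f zero    = refl
tabulate-toℕ f (suc n) = cong (f 0 ∷_) (tabulate-toℕ (f ∘ suc) n)

map-toℕ-reverse : ∀ n → map toℕ (reverse (allFin n)) ≡ downFrom n
map-toℕ-reverse n = begin
  map toℕ (reverse (allFin n))  ≡⟨ List.reverse-map toℕ (allFin n) ⟩
  reverse (map toℕ (allFin n))  ≡⟨ cong reverse (List.map-tabulate {n = n} id toℕ) ⟩
  reverse (tabulate {n = n} toℕ) ≡⟨ cong reverse (tabulate-toℕ id n) ⟩
  reverse (upTo n)              ≡⟨ List.reverse-upTo n ⟩
  downFrom n                    ∎
  where open ≡-Reasoning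

#lbsum-difference : ∀ n → + #lbsum n 0ℙ - + #lbsum n 1ℙ ≡ signedSum n
#lbsum-difference n = begin
  + #lbsum n 0ℙ - + #lbsum n 1ℙ
    ≡⟨ sumOver-sgn (parity ∘ lbsum) (𝒮 n) ⟨
  sumOver (sgn ∘ parity ∘ lbsum) (𝒮 n)
    ≡⟨ sumOver-cong (𝒮 n) (cong (sgn ∘ parity) ∘ lbsum-borders) ⟩
  sumOver (weight ∘ map toℕ ∘ toList) (𝒮 n)
    -- `sumOver-𝒮` leaves the order of the letters free; the reversed one becomes `downFrom n` under
    -- `toℕ`.
    ≡⟨ sumOver-𝒮 n (weight ∘ map toℕ)
         (Distinct-↭ (↭-sym (↭-reverse (allFin n))) (Distinct.allFin⁺ n))
         (trans (List.length-reverse (allFin n)) (List.length-tabulate id))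
         (λ a → ∈-resp-↭ (↭-sym (↭-reverse (allFin n))) (∈-allFin a)) ⟩
  permSum (weight ∘ map toℕ) (reverse (allFin n))
    ≡⟨ permSum-map toℕ weight (reverse (allFin n)) ⟩
  permSum weight (map toℕ (reverse (allFin n)))
    ≡⟨ cong (permSum weight) (map-toℕ-reverse n) ⟩
  signedSum n ∎
  where open ≡-Reasoning

+∣m-n∣≡+m-+n : ∀ m n → 0ℤ ℤ.≤ + m - + n → + ∣ m - n ∣ ≡ + m - + n
+∣m-n∣≡+m-+n m n 0≤m-n = begin
  + ∣ m - n ∣     ≡⟨ cong +_ (trans (ℕ.∣-∣-comm m n) (ℕ.m≤n⇒∣m-n∣≡n∸m n≤m)) ⟩
  + (m ℕ.∸ n)     ≡⟨ ℤ.⊖-≥ n≤m ⟨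
  m ℤ.⊖ n         ≡⟨ ℤ.[+m]-[+n]≡m⊖n m n ⟨
  + m - + n       ∎
  where
  open ≡-Reasoning
  n≤m : n ≤ m
  n≤m = ℤ.drop‿+≤+ (ℤ.0≤i-j⇒j≤i 0≤m-n)

open Tangent oddPart refl oddPart-suc using (⊙-cos)

proposition2p1 : ∀ (n : ℕ) → 1 ≤ n →
    (parity n ≡ 0ℙ → #lbsum n 0ℙ ≡ #lbsum n 1ℙ) ×
    (parity n ≡ 1ℙ → + ∣ #lbsum n 0ℙ - #lbsum n 1ℙ ∣ / 1 ≡ T n)
proposition2p1 n@(suc m) _ = even , odd
  where
  open ≡-Reasoning
  even : parity n ≡ 0ℙ → #lbsum n 0ℙ ≡ #lbsum n 1ℙ
  even p≡0 = ℤ.+-injective (ℤ.i-j≡0⇒i≡j (+ #lbsum n 0ℙ) (+ #lbsum n 1ℙ)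
    -- As `n` is a successor, `signedSum n` is `oddPart n` by definition; at 0 the counts would be 1
    -- and 0.
    (trans (#lbsum-difference n) (oddPart-even n p≡0)))
  odd : parity n ≡ 1ℙ → + ∣ #lbsum n 0ℙ - #lbsum n 1ℙ ∣ / 1 ≡ T n
  odd _ = begin
    + ∣ #lbsum n 0ℙ - #lbsum n 1ℙ ∣ / 1
      ≡⟨ cong (_/ 1) (+∣m-n∣≡+m-+n (#lbsum n 0ℙ) (#lbsum n 1ℙ)
           (subst (0ℤ ℤ.≤_) (sym (#lbsum-difference n)) (signedSum-nonNeg n n ℕ.≤-refl))) ⟩
    (+ #lbsum n 0ℙ - + #lbsum n 1ℙ) / 1
      ≡⟨ cong (_/ 1) (#lbsum-difference n) ⟩
    oddPart n / 1
      ≡⟨ T-⊙-cos oddPart ⊙-cos n ⟨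
    T n ∎
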